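{- Let $\ell\ge r\ge2$ and let $\mathcal{H}$ be a $\mathcal{K}_{\ell+1}^r$-free $r$-graph. Then for every integer $i$ with $r-\ell\le i\le r-2$, \[ \left(\frac{|\partial_i\mathcal{H}|}{\binom{\ell}{r-i}}\right)^{\frac{1}{r-i}}\le\left(\frac{|\partial_{i+1}\mathcal{H}|}{\binom{\ell}{r-i-1}}\right)^{\frac{1}{r-i-1}}; \] that is, \[ \left(\frac{|\partial_{r-\ell}\mathcal{H}|}{\binom{\ell}{\ell}}\right)^{\frac1\ell}\le\cdots\le\left(\frac{|\partial_{ -1}\mathcal{H}|}{\binom{\ell}{r+1}}\right)^{\frac{1}{r+1}}\le\left(\frac{|\mathcal{H}|}{\binom{\ell}{r}}\right)^{\frac1r}\le\left(\frac{|\partial_1\mathcal{H}|}{\binom{\ell}{r-1}}\right)^{\frac{1}{r-1}}\le\cdots\le\left(\frac{|\partial_{r-1}\mathcal{H}|}{\binom{\ell}{1}}\right)^{\frac11}. \]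
   Context: An $r$-graph $\mathcal{H}$ is a finite vertex set $V(\mathcal{H})$ together with a set of $r$-element subsets (edges). $\mathcal{H}$ is $\mathcal{F}$-free if it contains no member of the family $\mathcal{F}$ as a (not necessarily induced) subgraph. $\mathcal{K}_{\ell+1}^r$ is the collection of all $r$-graphs $F$ with at most $\binom{\ell+1}{2}$ edges such that for some $(\ell+1)$-set $S$ every pair $\{u,v\}\subset S$ is contained in some edge of $F$. For $1\le i\le r-1$, the $i$-th shadow is $\partial_i\mathcal{H}=\{A\in\binom{V(\mathcal{H})}{r-i}: A\subset B\text{ for some }B\in\mathcal{H}\}$; for $i\le0$, $\partial_i\mathcal{H}=\{A\in\binom{V(\mathcal{H})}{r-i}: \mathcal{H}[A]\text{ is a complete } r\text{ -graph}\}$, where $\mathcal{H}[A]$ is the induced subgraph on $A$. In particular $\partial_0\mathcal{H}=\mathcal{H}$. -}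

module Defs where

open import Level using (0ℓ)
open import Data.Bool using (Bool; true; false; if_then_else_)
open import Data.Nat using (ℕ; zero; suc; _+_; _∸_; _≤_)
import Data.Nat as ℕ
open import Data.Nat.Combinatorics using (_C_)
open import Data.Integer using (ℤ; +_; -[1+_])
open import Data.Fin using (Fin)
open import Data.Fin.Properties using (any?)
import Data.Fin as Fin
open import Data.Fin.Subset using (Subset; _∈_; _∉_; _⊆_; ∣_∣; inside; outside)
open import Data.Fin.Subset.Properties using (_∈?_; _⊆?_; anySubset?)
open import Data.Vec using ([]; _∷_; tabulate)
open import Data.Product using (Σ; ∃; _×_; _,_)
open import Data.Product.Properties using () 
open import Function using (_∘_)
open import Function.Definitions using (Injective)
open import Relation.Unary using (Pred; Decidable)
open import Relation.Nullary using (¬_; Dec; yes; no; does)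
open import Relation.Nullary.Decidable using (_×-dec_; ¬?; decidable-stable)
open import Relation.Binary.PropositionalEquality using (_≡_; _≢_)

countSub : ∀ n {P : Pred (Subset n) 0ℓ} → Decidable P → ℕ
countSub zero    P? = if does (P? []) then 1 else 0
countSub (suc n) P? = countSub n (P? ∘ (inside ∷_)) + countSub n (P? ∘ (outside ∷_))

allSubset? : ∀ {n} {P : Pred (Subset n) 0ℓ} → Decidable P → Dec (∀ A → P A)
allSubset? {P = P} P? with anySubset? (λ A → ¬? (P? A))
... | yes (A , ¬pA) = no (λ h → ¬pA (h A))
... | no ¬∃ = yes (λ A → decidable-stable (P? A) (λ ¬pA → ¬∃ (A , ¬pA)))

record RGraph (n r : ℕ) : Set₁ where
  field
    Edge    : Pred (Subset n) 0ℓ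
    edge?   : Decidable Edge
    uniform : ∀ {A} → Edge A → ∣ A ∣ ≡ r
open RGraph public

∣E∣ : ∀ {n r} → RGraph n r → ℕ
∣E∣ {n} H = countSub n (edge? H)

image : ∀ {m n} → (Fin m → Fin n) → Subset m → Subset n
image f B = tabulate (λ y → does (any? (λ x → (x ∈? B) ×-dec (f x Fin.≟ y))))

Embeds : ∀ {m n r} → RGraph m r → RGraph n r → Set
Embeds {m} {n} F H =
  Σ (Fin m → Fin n) λ f → Injective _≡_ _≡_ f × (∀ B → Edge F B → Edge H (image f B))

InK : ∀ {m r} → (ℓ : ℕ) → RGraph m r → Set
InK {m} ℓ F =
  ∣E∣ F ≤ (suc ℓ C 2) ×
  ∃ λ (S : Subset m) → ∣ S ∣ ≡ suc ℓ ×
    (∀ u v → u ∈ S → v ∈ S → u ≢ v → ∃ λ B → Edge F B × u ∈ B × v ∈ B)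

KFree : ∀ {n r} → (ℓ : ℕ) → RGraph n r → Set₁
KFree {r = r} ℓ H = ∀ m (F : RGraph m r) → InK ℓ F → ¬ Embeds F H

sz : ℕ → ℤ → ℕ
sz r (+ k)     = r ∸ k
sz r -[1+ j ]  = r + suc j

ShadowCond : ∀ {n r} → RGraph n r → ℤ → Pred (Subset n) 0ℓ
ShadowCond H (+ suc j) A = ∃ λ B → Edge H B × A ⊆ B
ShadowCond {r = r} H (+ zero) A = ∀ C → C ⊆ A → ∣ C ∣ ≡ r → Edge H C
ShadowCond {r = r} H -[1+ j ] A = ∀ C → C ⊆ A → ∣ C ∣ ≡ r → Edge H C

Shadow : ∀ {n r} → RGraph n r → ℤ → Pred (Subset n) 0ℓ
Shadow {r = r} H i A = ∣ A ∣ ≡ sz r i × ShadowCond H i A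

completeSub? : ∀ {n r} (H : RGraph n r) → Decidable (λ A → ∀ C → C ⊆ A → ∣ C ∣ ≡ r → Edge H C)
completeSub? {r = r} H A =
  allSubset? (λ C → impl (C ⊆? A) (impl (∣ C ∣ ℕ.≟ r) (edge? H C)))
  where
  impl : ∀ {P Q : Set} → Dec P → Dec Q → Dec (P → Q)
  impl _ (yes q) = yes (λ _ → q)
  impl (no ¬p) (no _) = yes (λ p → Data.Empty.⊥-elim (¬p p))
    where import Data.Empty
  impl (yes p) (no ¬q) = no (λ f → ¬q (f p))

shadowCond? : ∀ {n r} (H : RGraph n r) i → Decidable (ShadowCond H i)
shadowCond? H (+ suc j) A = anySubset? (λ B → edge? H B ×-dec (A ⊆? B))
shadowCond? H (+ zero) = completeSub? H
shadowCond? H -[1+ j ] = completeSub? H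

shadow? : ∀ {n r} (H : RGraph n r) i → Decidable (Shadow H i)
shadow? {r = r} H i A = (∣ A ∣ ℕ.≟ sz r i) ×-dec shadowCond? H i A

∣∂∣ : ∀ {n r} → RGraph n r → ℤ → ℕ
∣∂∣ {n} H i = countSub n (shadow? H i)

{-# OPTIONS --safe #-}
module Submission where

-- Entropy method. Put p = r - i and let (X₁ , … , X_p) be a uniformly random ordering of a uniformly
-- random member of ∂_i H. All pairs inside members of ∂_i H lie in edges of H, so the pairs form a
-- K_{ℓ+1}-free graph. Conditioned on X₁ , … , X_j, the vertices X_{j+1} and X_{j+2} are adjacent in a
-- K_{ℓ-j+1}-free graph, so Gibbs' inequality and the Motzkin–Straus theorem give
--   H(X_{j+2} | X₁ … X_{j+1}) ≤ H(X_{j+1} | X₁ … X_j) + log (1 - 1 / (ℓ - j)).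
-- Comparing every increment with the last one, and bounding H(X₁ … X_{p-1}) by the logarithm of
-- (p - 1)! |∂_{i+1} H|, yields the claim. Everything is exponentiated and cleared of denominators, so
-- that only products and powers of natural numbers occur.

open import Defs
open import Level using (0ℓ)
open import Data.Bool using (Bool; true; false; not; _∧_; T; if_then_else_)
import Data.Bool as Bool
open import Data.Bool.Properties using (T-∧; ∧-comm)
open import Data.Empty using (⊥-elim)
open import Data.Fin using (Fin; zero; suc)
import Data.Fin as Fin
import Data.Fin.Properties as Fin
open import Data.Fin.Subset using (Subset; _∈_; _∉_; _⊆_; ∣_∣; inside; outside) renaming (⊥ to ∅)
open import Data.Fin.Subset.Properties using (∉⊥; ∣⊥∣≡0; drop-∷-⊆; s⊆s; out⊆; ⊆-refl; ⊆-trans; _∈?_)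
open import Data.List using (List; []; _∷_; replicate; length; _++_; foldr)
import Data.List as List using (map)
import Data.List.Properties as List
import Data.List.Membership.Propositional as List using (_∈_)
open import Data.List.Membership.Propositional using (find)
import Data.List.Membership.DecPropositional as DecMembership
open import Data.List.Relation.Unary.All as All using (All; []; _∷_)
import Data.List.Relation.Unary.All.Properties as All
open import Data.List.Relation.Unary.AllPairs as AllPairs using (AllPairs; []; _∷_)
import Data.List.Relation.Unary.AllPairs.Properties as AllPairs
open import Data.List.Relation.Unary.Any as Any using (Any; here; there)
import Data.List.Relation.Unary.Any.Properties as Any
open import Data.Nat
open import Data.Nat.Combinatorics
  using (_C_; nCk≡n!/k![n-k]!; k![n∸k]!∣n!; nCk+nC[k+1]≡[n+1]C[k+1]; nC1≡n)
open import Data.Nat.DivMod using (m/n*n≡m)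
open import Data.Nat.GeneralisedArithmetic using (fold; fold-+)
open import Data.Nat.ListAction using (sum; product)
open import Data.Nat.ListAction.Properties using (sum-++; product-++)
open import Data.Nat.Properties
open import Data.Nat.Tactic.RingSolver using (solve-∀)
open import Data.Product
open import Data.Sum using (_⊎_; inj₁; inj₂)
open import Data.Vec using ([]; _∷_; lookup; _[_]≔_; here; there)
open import Data.Vec.Properties
  using ([]≔-commutes; []≔-updates; []≔-minimal; lookup∘updateAt′; []=⇒lookup; lookup⇒[]=;
         ≡-dec; tabulate∘lookup; tabulate-cong)
open import Function using (_∘_; id; Equivalence)
open import Relation.Binary.PropositionalEquality
open import Relation.Nullary using (Dec; yes; no; does)
open import Relation.Nullary.Decidable using (dec-true; dec-false; _×-dec_)
open import Relation.Unary using (Pred; Decidable)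
open import Algebra.Properties.CommutativeMonoid.Sum +-0-commutativeMonoid
  using () renaming (sum to ∑; sum-cong-≗ to ∑-cong; ∑-distrib-+ to ∑-distrib; ∑-comm to ∑-swap)
open import Algebra.Properties.CommutativeMonoid.Sum *-1-commutativeMonoid
  using () renaming (sum to ∏; sum-cong-≗ to ∏-cong; ∑-distrib-+ to ∏-distrib; ∑-comm to ∏-swap)
open import Algebra.Properties.Semiring.Sum +-*-semiring using (*-distribˡ-sum; *-distribʳ-sum)

-- Gibbs' inequality

-- The loss 1 - 1 / (ℓ - j) is the Turán density of a link: a clique there together with X₁ ... X_j
-- is pairwise covered, so it has at most ℓ - j vertices. Because the ordering is uniform, X_{j+1}
-- and X_{j+2} are exchangeable given the prefix, so a bound on the entropy of the pair becomes a
-- comparison of consecutive increments. The last increment is singled out because it alone sees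
-- both shadows: it is H(X₁ ... X_p) - H(X₁ ... X_{p-1}), where the first term is log (p! |∂_i H|)
-- exactly. The ratios (ℓ - j) / (ℓ - p + 1) left by the comparisons multiply to a quotient of
-- factorials, the source of the binomial coefficients. Exponentiated entropies become products of
-- `c ^ c` over integer counts `c`, in which entropy enters with a minus sign.

^-distribʳ-* : ∀ m n k → (m * n) ^ k ≡ m ^ k * n ^ k
^-distribʳ-* m n zero = refl
^-distribʳ-* m n (suc k) rewrite ^-distribʳ-* m n k = lem m n (m ^ k) (n ^ k)
  where
  lem : ∀ a b c d → a * b * (c * d) ≡ a * c * (b * d)
  lem = solve-∀

-- The convention `0 ^ 0 = 1` lets normalising factors such as `S ^ S` be cancelled even when the
-- total weight is zero.
n^n≢0 : ∀ n → NonZero (n ^ n)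
n^n≢0 zero = _
n^n≢0 (suc n) = m^n≢0 (suc n) (suc n)

2*m*n≤m*m+n*n : ∀ m n → 2 * (m * n) ≤ m * m + n * n
2*m*n≤m*m+n*n m n with ≤-total m n
... | inj₁ m≤n with d , refl ← m≤n⇒∃[o]m+o≡n m≤n = subst (2 * (m * (m + d)) ≤_) (lem m d) (m≤m+n _ (d * d))
  where
  lem : ∀ m d → 2 * (m * (m + d)) + d * d ≡ m * m + (m + d) * (m + d)
  lem = solve-∀
... | inj₂ n≤m with d , refl ← m≤n⇒∃[o]m+o≡n n≤m = subst (2 * ((n + d) * n) ≤_) (lem n d) (m≤m+n _ (d * d))
  where
  lem : ∀ n d → 2 * ((n + d) * n) + d * d ≡ (n + d) * (n + d) + n * n
  lem = solve-∀

-- The graph of t ↦ t ^ (n + 1) lies above its tangent at v.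
tangent-≤ : ∀ n u v → suc n * (u * v ^ n) ≤ u * u ^ n + n * (v * v ^ n)
tangent-≤ zero u v = ≤-reflexive (lem u)
  where
  lem : ∀ u → 1 * (u * 1) ≡ u * 1 + 0
  lem = solve-∀
-- Padding both sides by the cancelled term exposes `2 * (u * v)`; after the bound by squares, `u`
-- times the induction hypothesis remains.
tangent-≤ (suc n) u v = +-cancelʳ-≤ (n * (u * (v * v ^ n))) _ _ (begin
  suc (suc n) * (u * (v * v ^ n)) + n * (u * (v * v ^ n))
    ≡⟨ lem₁ n u v (v ^ n) ⟩
  suc n * v ^ n * (2 * (u * v))
    ≤⟨ *-monoʳ-≤ (suc n * v ^ n) (2*m*n≤m*m+n*n u v) ⟩
  suc n * v ^ n * (u * u + v * v)
    ≡⟨ lem₂ n u v (v ^ n) ⟩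
  u * (suc n * (u * v ^ n)) + suc n * (v * (v * v ^ n))
    ≤⟨ +-monoˡ-≤ _ (*-monoʳ-≤ u (tangent-≤ n u v)) ⟩
  u * (u * u ^ n + n * (v * v ^ n)) + suc n * (v * (v * v ^ n))
    ≡⟨ lem₃ n u v (u ^ n) (v ^ n) ⟩
  u * (u * u ^ n) + suc n * (v * (v * v ^ n)) + n * (u * (v * v ^ n)) ∎)
  where
  open ≤-Reasoning
  lem₁ : ∀ n u v w → suc (suc n) * (u * (v * w)) + n * (u * (v * w)) ≡ suc n * w * (2 * (u * v))
  lem₁ = solve-∀
  lem₂ : ∀ n u v w → suc n * w * (u * u + v * v) ≡ u * (suc n * (u * w)) + suc n * (v * (v * w))
  lem₂ = solve-∀
  lem₃ : ∀ n u v z w → u * (u * z + n * (v * w)) + suc n * (v * (v * w))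
    ≡ u * (u * z) + suc n * (v * (v * w)) + n * (u * (v * w))
  lem₃ = solve-∀

-- In the proof, `u` and `v` are the mean of all `suc n` numbers and the mean of the `n` old ones,
-- both scaled by `n * suc n`.
amgm-step : ∀ n s x → suc n ^ suc n * (x * s ^ n) ≤ n ^ n * (x + s) ^ suc n
amgm-step zero s x = ≤-trans (≤-reflexive (lem x)) (≤-trans (m≤m+n x s) (≤-reflexive (lem′ (x + s))))
  where
  lem : ∀ x → 1 * (x * 1) ≡ x
  lem = solve-∀
  lem′ : ∀ x → x ≡ 1 * (x * 1)
  lem′ = solve-∀
amgm-step n@(suc k) s x = *-cancelˡ-≤ n (+-cancelʳ-≤ (n * (v * v ^ n)) _ _ (begin
  n * (suc n * suc n ^ n * (x * s ^ n)) + n * (v * v ^ n)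
    ≡⟨ cong (λ z → n * (suc n * suc n ^ n * (x * s ^ n)) + n * (v * z)) (^-distribʳ-* s (suc n) n) ⟩
  n * (suc n * suc n ^ n * (x * s ^ n)) + n * (v * (s ^ n * suc n ^ n))
    ≡⟨ lem₁ n s x (s ^ n) (suc n ^ n) ⟩
  suc n * (u * (s ^ n * suc n ^ n))
    ≡⟨ cong (λ z → suc n * (u * z)) (^-distribʳ-* s (suc n) n) ⟨
  suc n * (u * v ^ n)
    ≤⟨ tangent-≤ n u v ⟩
  u * u ^ n + n * (v * v ^ n)
    ≡⟨ cong (λ z → u * z + n * (v * v ^ n)) (^-distribʳ-* n (x + s) n) ⟩
  n * (x + s) * (n ^ n * (x + s) ^ n) + n * (v * v ^ n)
    ≡⟨ cong (_+ n * (v * v ^ n)) (lem₂ n (x + s) (n ^ n) ((x + s) ^ n)) ⟩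
  n * (n ^ n * (x + s) ^ suc n) + n * (v * v ^ n) ∎))
  where
  open ≤-Reasoning
  u = n * (x + s)
  v = s * suc n
  lem₁ : ∀ n s x a b → n * (suc n * b * (x * a)) + n * (s * suc n * (a * b)) ≡ suc n * (n * (x + s) * (a * b))
  lem₁ = solve-∀
  lem₂ : ∀ n y a b → n * y * (a * b) ≡ n * (a * (y * b))
  lem₂ = solve-∀

amgm : ∀ xs → length xs ^ length xs * product xs ≤ sum xs ^ length xs
amgm [] = ≤-refl
amgm (x ∷ xs) = *-cancelˡ-≤ (n ^ n) {{n^n≢0 n}} (begin
  n ^ n * (suc n ^ suc n * (x * product xs)) ≡⟨ lem (n ^ n) (suc n ^ suc n) x (product xs) ⟩
  suc n ^ suc n * (x * (n ^ n * product xs)) ≤⟨ *-monoʳ-≤ (suc n ^ suc n) (*-monoʳ-≤ x (amgm xs)) ⟩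
  suc n ^ suc n * (x * sum xs ^ n)           ≤⟨ amgm-step n (sum xs) x ⟩
  n ^ n * (x + sum xs) ^ suc n               ∎)
  where
  open ≤-Reasoning
  n = length xs
  lem : ∀ a b c d → a * (b * (c * d)) ≡ b * (c * (a * d))
  lem = solve-∀

sum-replicate : ∀ n x → sum (replicate n x) ≡ n * x
sum-replicate zero x = refl
sum-replicate (suc n) x = cong (x +_) (sum-replicate n x)

product-replicate : ∀ n x → product (replicate n x) ≡ x ^ n
product-replicate zero x = refl
product-replicate (suc n) x = cong (x *_) (product-replicate n x)

-- AM-GM for a copies of x * b and b copies of y * a.
weighted-amgm : ∀ a b x y → (a + b) ^ (a + b) * (x ^ a * y ^ b) ≤ a ^ a * b ^ b * (x + y) ^ (a + b)
weighted-amgm zero b x y = begin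
  b ^ b * (1 * y ^ b)       ≡⟨ lem (b ^ b) (y ^ b) ⟩
  1 * b ^ b * y ^ b         ≤⟨ *-monoʳ-≤ (1 * b ^ b) (^-monoˡ-≤ b (m≤n+m y x)) ⟩
  1 * b ^ b * (x + y) ^ b   ∎
  where
  open ≤-Reasoning
  lem : ∀ a b → a * (1 * b) ≡ 1 * a * b
  lem = solve-∀
weighted-amgm a@(suc k) zero x y rewrite +-identityʳ k = begin
  a ^ a * (x ^ a * 1)       ≡⟨ lem (a ^ a) (x ^ a) ⟩
  a ^ a * 1 * x ^ a         ≤⟨ *-monoʳ-≤ (a ^ a * 1) (^-monoˡ-≤ a (m≤m+n x y)) ⟩
  a ^ a * 1 * (x + y) ^ a   ∎
  where
  open ≤-Reasoning
  lem : ∀ a b → a * (b * 1) ≡ a * 1 * b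
  lem = solve-∀
weighted-amgm a@(suc _) b@(suc _) x y =
  -- The numbers to average are x / a and y / b; scaling by `a * b` keeps them integral at the price
  -- of this factor, nonzero since both weights are positive.
  *-cancelʳ-≤ _ _ (b ^ a * a ^ b) {{m*n≢0 _ _ {{m^n≢0 b a}} {{m^n≢0 a b}}}} (begin
  (a + b) ^ (a + b) * (x ^ a * y ^ b) * (b ^ a * a ^ b)
    ≡⟨ lem₁ ((a + b) ^ (a + b)) (x ^ a) (y ^ b) (b ^ a) (a ^ b) ⟩
  (a + b) ^ (a + b) * (x ^ a * b ^ a * (y ^ b * a ^ b))
    ≡⟨ cong ((a + b) ^ (a + b) *_) prod-eq ⟨
  (a + b) ^ (a + b) * product l
    ≡⟨ cong (λ n → n ^ n * product l) len-eq ⟨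
  length l ^ length l * product l
    ≤⟨ amgm l ⟩
  sum l ^ length l
    ≡⟨ cong₂ _^_ sum-eq len-eq ⟩
  (a * b * (x + y)) ^ (a + b)
    ≡⟨ ^-distribʳ-* (a * b) (x + y) (a + b) ⟩
  (a * b) ^ (a + b) * z
    ≡⟨ cong (_* z) (^-distribʳ-* a b (a + b)) ⟩
  a ^ (a + b) * b ^ (a + b) * z
    ≡⟨ cong₂ (λ s t → s * t * z) (^-distribˡ-+-* a a b) (^-distribˡ-+-* b a b) ⟩
  a ^ a * a ^ b * (b ^ a * b ^ b) * z
    ≡⟨ lem₂ (a ^ a) (a ^ b) (b ^ a) (b ^ b) z ⟩
  a ^ a * b ^ b * z * (b ^ a * a ^ b) ∎)
  where
  open ≤-Reasoning
  z = (x + y) ^ (a + b)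
  l = replicate a (x * b) ++ replicate b (y * a)
  lem₁ : ∀ t p q r s → t * (p * q) * (r * s) ≡ t * (p * r * (q * s))
  lem₁ = solve-∀
  lem₂ : ∀ p q r s t → p * q * (r * s) * t ≡ p * s * t * (r * q)
  lem₂ = solve-∀
  lem₃ : ∀ a b x y → a * (x * b) + b * (y * a) ≡ a * b * (x + y)
  lem₃ = solve-∀
  len-eq : length l ≡ a + b
  len-eq = trans (List.length-++ (replicate a (x * b))) (cong₂ _+_ (List.length-replicate a) (List.length-replicate b))
  sum-eq : sum l ≡ a * b * (x + y)
  sum-eq = trans (sum-++ (replicate a (x * b)) _)
    (trans (cong₂ _+_ (sum-replicate a (x * b)) (sum-replicate b (y * a))) (lem₃ a b x y))
  prod-eq : product l ≡ x ^ a * b ^ a * (y ^ b * a ^ b)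
  prod-eq = trans (product-++ (replicate a (x * b)) _)
    (cong₂ _*_ (trans (product-replicate a (x * b)) (^-distribʳ-* x b a))
               (trans (product-replicate b (y * a)) (^-distribʳ-* y a b)))

-- Gibbs' inequality for the distributions a / ∑ a and b / ∑ b, with the logarithms exponentiated.
gibbs : ∀ {n} (a b : Fin n → ℕ) →
  ∏ (λ x → b x ^ a x) * ∑ a ^ ∑ a ≤ ∏ (λ x → a x ^ a x) * ∑ b ^ ∑ a
gibbs {zero} a b = ≤-refl
-- Chain rule for relative entropy: the tail is compared within itself, then merged into one outcome
-- of weights `S` and `B` set against the head.
gibbs {suc n} a b = *-cancelʳ-≤ _ _ (S ^ S) {{n^n≢0 S}} (begin
  b₀ ^ a₀ * P * W * S ^ S                   ≡⟨ lem₁ (b₀ ^ a₀) P W (S ^ S) ⟩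
  b₀ ^ a₀ * W * (P * S ^ S)                 ≤⟨ *-monoʳ-≤ (b₀ ^ a₀ * W) (gibbs (a ∘ suc) (b ∘ suc)) ⟩
  b₀ ^ a₀ * W * (Q * B ^ S)                 ≡⟨ lem₂ (b₀ ^ a₀) W Q (B ^ S) ⟩
  Q * (W * (b₀ ^ a₀ * B ^ S))               ≤⟨ *-monoʳ-≤ Q (weighted-amgm a₀ S b₀ B) ⟩
  Q * (a₀ ^ a₀ * S ^ S * (b₀ + B) ^ (a₀ + S)) ≡⟨ lem₃ Q (a₀ ^ a₀) (S ^ S) ((b₀ + B) ^ (a₀ + S)) ⟩
  a₀ ^ a₀ * Q * (b₀ + B) ^ (a₀ + S) * S ^ S ∎)
  where
  open ≤-Reasoning
  a₀ = a zero
  b₀ = b zero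
  S = ∑ (a ∘ suc)
  B = ∑ (b ∘ suc)
  P = ∏ (λ x → b (suc x) ^ a (suc x))
  Q = ∏ (λ x → a (suc x) ^ a (suc x))
  W = (a₀ + S) ^ (a₀ + S)
  lem₁ : ∀ b p t s → b * p * t * s ≡ b * t * (p * s)
  lem₁ = solve-∀
  lem₂ : ∀ b t q s → b * t * (q * s) ≡ q * (t * (b * s))
  lem₂ = solve-∀
  lem₃ : ∀ q a s b → q * (a * s * b) ≡ a * q * b * s
  lem₃ = solve-∀

-- The Motzkin–Straus theorem

∑-mono : ∀ {n} {f g : Fin n → ℕ} → (∀ x → f x ≤ g x) → ∑ f ≤ ∑ g
∑-mono {zero} f≤g = z≤n
∑-mono {suc n} f≤g = +-mono-≤ (f≤g zero) (∑-mono (f≤g ∘ suc))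

∑≡0 : ∀ {n} {f : Fin n → ℕ} → (∀ x → f x ≡ 0) → ∑ f ≡ 0
∑≡0 {zero} f≡0 = refl
∑≡0 {suc n} f≡0 = cong₂ _+_ (f≡0 zero) (∑≡0 (f≡0 ∘ suc))

argmax : ∀ {n} (f : Fin (suc n) → ℕ) → ∃ λ v → ∀ x → f x ≤ f v
argmax {zero} f = zero , λ { zero → ≤-refl }
argmax {suc n} f with argmax (f ∘ suc)
... | v , max with ≤-total (f zero) (f (suc v))
... | inj₁ 0≤v = suc v , λ { zero → 0≤v ; (suc x) → max x }
... | inj₂ v≤0 = zero , λ { zero → ≤-refl ; (suc x) → ≤-trans (max x) v≤0 }

⟦_⟧ : Bool → ℕ
⟦ true ⟧ = 1
⟦ false ⟧ = 0

degree : ∀ {n} → (Fin n → Fin n → Bool) → (Fin n → ℕ) → Fin n → ℕ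
degree adj w x = ∑ λ y → ⟦ adj x y ⟧ * w y

Clique : ∀ {n} → (Fin n → Fin n → Bool) → List (Fin n) → Set
Clique adj = AllPairs (λ x y → T (adj x y))

-- Induction on the clique number: pass to the neighbourhood of a vertex v of maximal weighted degree;
-- a pair meeting the complement of that neighbourhood is charged to an endpoint in the complement.
motzkin-straus : ∀ {n} m (adj : Fin n → Fin n → Bool) (w : Fin n → ℕ) →
  (∀ x y → adj x y ≡ adj y x) → (∀ xs → Clique adj xs → length xs ≢ suc (suc m)) →
  suc m * ∑ (λ x → w x * degree adj w x) ≤ m * (∑ w * ∑ w)
motzkin-straus zero adj w adj-sym free = ≤-reflexive (cong (_+ 0) (∑≡0 λ x →
  trans (cong (w x *_) (∑≡0 λ y → no-edge x y)) (*-zeroʳ (w x))))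
  where
  no-edge : ∀ x y → ⟦ adj x y ⟧ * w y ≡ 0
  no-edge x y with adj x y in eq
  ... | false = refl
  ... | true = ⊥-elim (free (x ∷ y ∷ []) ((subst T (sym eq) _ ∷ []) ∷ [] ∷ []) refl)
motzkin-straus {zero} (suc m) adj w adj-sym free = ≤-reflexive (trans (*-zeroʳ m) (sym (*-zeroʳ m)))
motzkin-straus {suc n} (suc m) adj w adj-sym free with argmax (degree adj w)
-- The extra factor `suc m` makes room for the square inequality between `a` and `suc m * b`, tight
-- when the complement carries a 1 / (m + 2) share of the weight.
... | v , δ≤δv = *-cancelˡ-≤ (suc m) (begin
  suc m * (suc (suc m) * Q)
    ≤⟨ *-monoʳ-≤ (suc m) (*-monoʳ-≤ (suc (suc m)) Q≤) ⟩
  suc m * (suc (suc m) * (Q′ + (b * a + b * a)))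
    ≡⟨ lem₁ m Q′ a b ⟩
  suc (suc m) * (suc m * Q′) + suc m * suc m * (2 * (a * b)) + 2 * (a * (suc m * b))
    ≤⟨ +-mono-≤ (+-monoˡ-≤ _ (*-monoʳ-≤ (suc (suc m)) IH)) (2*m*n≤m*m+n*n a (suc m * b)) ⟩
  suc (suc m) * (m * (a * a)) + suc m * suc m * (2 * (a * b)) + (a * a + suc m * b * (suc m * b))
    ≡⟨ lem₂ m a b ⟩
  suc m * (suc m * ((a + b) * (a + b)))
    ≡⟨ cong (λ s → suc m * (suc m * (s * s))) S≡a+b ⟨
  suc m * (suc m * (∑ w * ∑ w)) ∎)
  where
  open ≤-Reasoning
  δ = degree adj w
  -- The vertex set is kept: edges and weights outside the neighbourhood are zeroed, and the
  -- recursion runs on `m` alone.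
  adj′ : Fin (suc n) → Fin (suc n) → Bool
  adj′ x y = adj x y ∧ (adj v x ∧ adj v y)
  w′ w° : Fin (suc n) → ℕ
  w′ x = ⟦ adj v x ⟧ * w x
  w° x = ⟦ not (adj v x) ⟧ * w x
  a = ∑ w′
  b = ∑ w°
  Q = ∑ (λ x → w x * δ x)
  Q′ = ∑ (λ x → w′ x * degree adj′ w′ x)

  free′ : ∀ xs → Clique adj′ xs → length xs ≢ suc (suc m)
  -- Adjacency to `v` is recorded in the edges of `adj′`; it can be read off because the clique has
  -- at least two vertices.
  free′ (x ∷ y ∷ xs) c@((xy ∷ xxs) ∷ _) eq =
    free (v ∷ x ∷ y ∷ xs)
      ((proj₁ (vxy xy) ∷ proj₂ (vxy xy) ∷ All.map (proj₂ ∘ vxy) xxs) ∷ AllPairs.map (λ {x} {y} → proj₁ ∘ Equivalence.to (T-∧ {adj x y})) c)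
      (cong suc eq)
    where
    vxy : ∀ {x y} → T (adj′ x y) → T (adj v x) × T (adj v y)
    vxy {x} {y} = Equivalence.to T-∧ ∘ proj₂ ∘ Equivalence.to (T-∧ {adj x y})
  IH : suc m * Q′ ≤ m * (a * a)
  IH = motzkin-straus m adj′ w′ (λ x y → cong₂ _∧_ (adj-sym x y) (∧-comm (adj v x) (adj v y))) free′

  S≡a+b : ∑ w ≡ a + b
  S≡a+b = trans (∑-cong split) (∑-distrib w′ w°)
    where
    split : ∀ x → w x ≡ w′ x + w° x
    split x with adj v x
    ... | true = lem (w x) where
      lem : ∀ w → w ≡ 1 * w + 0
      lem = solve-∀
    ... | false = sym (+-identityʳ (w x))

  pair : ∀ x y → w x * (⟦ adj x y ⟧ * w y)
    ≤ w′ x * (⟦ adj′ x y ⟧ * w′ y) + (w° x * (⟦ adj x y ⟧ * w y) + w° y * (⟦ adj y x ⟧ * w x))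
  pair x y rewrite adj-sym y x with adj x y | adj v x | adj v y
  ... | false | _ | _ = ≤-trans (≤-reflexive (*-zeroʳ (w x))) z≤n
  ... | true | true | true = ≤-trans (≤-reflexive (lem (w x) (w y))) (m≤m+n _ _)
    where
    lem : ∀ x y → x * (1 * y) ≡ 1 * x * (1 * (1 * y))
    lem = solve-∀
  ... | true | false | _ = ≤-trans (≤-reflexive (lem (w x) (w y))) (m≤m+n _ _)
    where
    lem : ∀ x y → x * (1 * y) ≡ 1 * x * (1 * y)
    lem = solve-∀
  ... | true | true | false = ≤-trans (≤-reflexive (lem (w x) (w y))) (m≤n+m _ _)
    where
    lem : ∀ x y → x * (1 * y) ≡ 1 * y * (1 * x)
    lem = solve-∀

  ∑δ : ∀ (u z : Fin (suc n) → ℕ) (adj : Fin (suc n) → Fin (suc n) → Bool) →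
    ∑ (λ x → ∑ (λ y → u x * (⟦ adj x y ⟧ * z y))) ≡ ∑ (λ x → u x * degree adj z x)
  ∑δ u z adj = ∑-cong λ x → sym (*-distribˡ-sum (u x) (λ y → ⟦ adj x y ⟧ * z y))

  ∑w°δ≤ : ∑ (λ x → w° x * δ x) ≤ b * a
  -- By definition the maximal degree `δ v` is `a`, the weight of the neighbourhood of `v`.
  ∑w°δ≤ = ≤-trans (∑-mono λ x → *-monoʳ-≤ (w° x) (δ≤δv x)) (≤-reflexive (sym (*-distribʳ-sum (δ v) w°)))

  Q≤ : Q ≤ Q′ + (b * a + b * a)
  Q≤ = begin
    Q
      ≡⟨ ∑δ w w adj ⟨
    ∑ (λ x → ∑ (λ y → w x * (⟦ adj x y ⟧ * w y)))
      ≤⟨ ∑-mono (λ x → ∑-mono (pair x)) ⟩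
    ∑ (λ x → ∑ (λ y → f x y + (g x y + g y x)))
      ≡⟨ ∑-cong (λ x → trans (∑-distrib (f x) (λ y → g x y + g y x)) (cong (∑ (f x) +_) (∑-distrib (g x) (λ y → g y x)))) ⟩
    ∑ (λ x → ∑ (f x) + (∑ (g x) + ∑ (λ y → g y x)))
      ≡⟨ trans (∑-distrib (∑ ∘ f) (λ x → ∑ (g x) + ∑ (λ y → g y x)))
          (cong (∑ (∑ ∘ f) +_) (∑-distrib (∑ ∘ g) (λ x → ∑ (λ y → g y x)))) ⟩
    ∑ (∑ ∘ f) + (∑ (∑ ∘ g) + ∑ (λ x → ∑ (λ y → g y x)))
      ≡⟨ cong (λ s → ∑ (∑ ∘ f) + (∑ (∑ ∘ g) + s)) (∑-swap (λ x y → g y x)) ⟩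
    ∑ (∑ ∘ f) + (∑ (∑ ∘ g) + ∑ (∑ ∘ g))
      ≡⟨ cong₂ (λ s t → s + (t + t)) (∑δ w′ w′ adj′) (∑δ w° w adj) ⟩
    Q′ + (∑ (λ x → w° x * δ x) + ∑ (λ x → w° x * δ x))
      ≤⟨ +-monoʳ-≤ Q′ (+-mono-≤ ∑w°δ≤ ∑w°δ≤) ⟩
    Q′ + (b * a + b * a) ∎
    where
    f g : Fin (suc n) → Fin (suc n) → ℕ
    f x y = w′ x * (⟦ adj′ x y ⟧ * w′ y)
    g x y = w° x * (⟦ adj x y ⟧ * w y)

  lem₁ : ∀ m q a b → suc m * (suc (suc m) * (q + (b * a + b * a)))
    ≡ suc (suc m) * (suc m * q) + suc m * suc m * (2 * (a * b)) + 2 * (a * (suc m * b))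
  lem₁ = solve-∀
  lem₂ : ∀ m a b → suc (suc m) * (m * (a * a)) + suc m * suc m * (2 * (a * b)) + (a * a + suc m * b * (suc m * b))
    ≡ suc m * (suc m * ((a + b) * (a + b)))
  lem₂ = solve-∀

-- Entropy of random tuples

∏-mono : ∀ {n} {f g : Fin n → ℕ} → (∀ x → f x ≤ g x) → ∏ f ≤ ∏ g
∏-mono {zero} f≤g = ≤-refl
∏-mono {suc n} f≤g = *-mono-≤ (f≤g zero) (∏-mono (f≤g ∘ suc))

∏-^ : ∀ {n} c (f : Fin n → ℕ) → ∏ (λ x → c ^ f x) ≡ c ^ ∑ f
∏-^ {zero} c f = refl
∏-^ {suc n} c f = trans (cong (c ^ f zero *_) (∏-^ c (f ∘ suc))) (sym (^-distribˡ-+-* c (f zero) (∑ (f ∘ suc))))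

∏≢0 : ∀ {n} {f : Fin n → ℕ} → (∀ x → NonZero (f x)) → NonZero (∏ f)
∏≢0 {zero} f≢0 = _
∏≢0 {suc n} f≢0 = m*n≢0 _ _ {{f≢0 zero}} {{∏≢0 (f≢0 ∘ suc)}}

∏≡1 : ∀ {n} {f : Fin n → ℕ} → (∀ x → f x ≡ 1) → ∏ f ≡ 1
∏≡1 {zero} f≡1 = refl
∏≡1 {suc n} f≡1 = cong₂ _*_ (f≡1 zero) (∏≡1 (f≡1 ∘ suc))

-- For a symmetric pair (X , Y) with joint weights c and marginal w, supported on a graph without
-- cliques of size m + 2, this is H(X , Y) ≤ 2 H(X) + log (m / (m + 1)), exponentiated: Gibbs' inequality
-- compares c with the product of the marginals restricted to the edges.
entropy-turán : ∀ {n} m (c : Fin n → Fin n → ℕ) → (∀ x y → c x y ≡ c y x) →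
  (∀ xs → Clique (λ x y → 0 <ᵇ c x y) xs → length xs ≢ suc (suc m)) →
  let w = λ x → ∑ (c x) ; S = ∑ w ; P = ∏ (λ x → w x ^ w x) in
  P * P * suc m ^ S ≤ ∏ (λ x → ∏ (λ y → c x y ^ c x y)) * m ^ S * S ^ S
entropy-turán {n} m c c-sym free = *-cancelʳ-≤ _ _ (S ^ S) {{n^n≢0 S}} (begin
  P * P * suc m ^ S * S ^ S   ≡⟨ lem₁ P (suc m ^ S) (S ^ S) ⟩
  P * P * S ^ S * suc m ^ S   ≤⟨ *-monoˡ-≤ (suc m ^ S) (*-monoˡ-≤ (S ^ S) step₂) ⟩
  R * Δ * S ^ S * suc m ^ S   ≡⟨ lem₂ R Δ (S ^ S) (suc m ^ S) ⟩
  R * suc m ^ S * (Δ * S ^ S) ≤⟨ *-monoʳ-≤ (R * suc m ^ S) step₃ ⟩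
  R * suc m ^ S * B ^ S       ≡⟨ trans (*-assoc R _ _) (cong (R *_) (sym (^-distribʳ-* (suc m) B S))) ⟩
  R * (suc m * B) ^ S         ≤⟨ *-monoʳ-≤ R (^-monoˡ-≤ S (motzkin-straus m adj w adj-sym free)) ⟩
  R * (m * (S * S)) ^ S       ≡⟨ cong (R *_) (trans (^-distribʳ-* m (S * S) S) (cong (m ^ S *_) (^-distribʳ-* S S S))) ⟩
  R * (m ^ S * (S ^ S * S ^ S)) ≡⟨ lem₃ R (m ^ S) (S ^ S) ⟩
  R * m ^ S * S ^ S * S ^ S   ∎)
  where
  open ≤-Reasoning
  adj : Fin n → Fin n → Bool
  adj x y = 0 <ᵇ c x y
  w δ : Fin n → ℕ
  w x = ∑ (c x)
  δ = degree adj w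
  S = ∑ w
  P = ∏ (λ x → w x ^ w x)
  R = ∏ (λ x → ∏ (λ y → c x y ^ c x y))
  B = ∑ (λ x → w x * δ x)
  Δ = ∏ (λ x → δ x ^ w x)

  adj-sym : ∀ x y → adj x y ≡ adj y x
  adj-sym x y = cong (0 <ᵇ_) (c-sym x y)

  -- A null pair has exponent zero, so the comparison weights can be cut down to the edges. Their
  -- total drops from `S` to `δ x`, which is the gain over plain subadditivity.
  mask : ∀ x y → w y ^ c x y ≡ (⟦ adj x y ⟧ * w y) ^ c x y
  mask x y with c x y
  ... | zero = refl
  ... | suc k = cong (_^ suc k) (sym (*-identityˡ (w y)))

  step₁ : ∀ x → ∏ (λ y → w y ^ c x y) * w x ^ w x ≤ ∏ (λ y → c x y ^ c x y) * δ x ^ w x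
  step₁ x = subst (λ z → z * w x ^ w x ≤ ∏ (λ y → c x y ^ c x y) * δ x ^ w x)
    (sym (∏-cong (mask x))) (gibbs (c x) (λ y → ⟦ adj x y ⟧ * w y))

  -- Symmetry makes both marginals equal: each `w y` is collected with total exponent `w y`.
  P≡ : ∏ (λ x → ∏ (λ y → w y ^ c x y)) ≡ P
  P≡ = trans (∏-swap (λ x y → w y ^ c x y))
    (∏-cong λ y → trans (∏-^ (w y) (λ x → c x y)) (cong (w y ^_) (∑-cong (λ x → c-sym x y))))

  step₂ : P * P ≤ R * Δ
  step₂ = begin
    P * P                                               ≡⟨ cong (_* P) P≡ ⟨
    ∏ (λ x → ∏ (λ y → w y ^ c x y)) * P                 ≡⟨ ∏-distrib (λ x → ∏ (λ y → w y ^ c x y)) (λ x → w x ^ w x) ⟨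
    ∏ (λ x → ∏ (λ y → w y ^ c x y) * w x ^ w x)         ≤⟨ ∏-mono step₁ ⟩
    ∏ (λ x → ∏ (λ y → c x y ^ c x y) * δ x ^ w x)       ≡⟨ ∏-distrib (λ x → ∏ (λ y → c x y ^ c x y)) (λ x → δ x ^ w x) ⟩
    R * Δ                                               ∎

  -- A second use of Gibbs' inequality turns the weighted geometric mean of the degrees into the
  -- edge sum `B`, which Motzkin-Straus bounds.
  step₃ : Δ * S ^ S ≤ B ^ S
  step₃ = *-cancelˡ-≤ P {{∏≢0 (λ x → n^n≢0 (w x))}} (begin
    P * (Δ * S ^ S)                       ≡⟨ *-assoc P Δ (S ^ S) ⟨
    P * Δ * S ^ S                         ≡⟨ cong (_* S ^ S) (∏-distrib (λ x → w x ^ w x) (λ x → δ x ^ w x)) ⟨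
    ∏ (λ x → w x ^ w x * δ x ^ w x) * S ^ S ≡⟨ cong (_* S ^ S) (∏-cong λ x → sym (^-distribʳ-* (w x) (δ x) (w x))) ⟩
    ∏ (λ x → (w x * δ x) ^ w x) * S ^ S   ≤⟨ gibbs w (λ x → w x * δ x) ⟩
    P * B ^ S                             ∎)

  lem₁ : ∀ p a b → p * p * a * b ≡ p * p * b * a
  lem₁ = solve-∀
  lem₂ : ∀ r d s a → r * d * s * a ≡ r * a * (d * s)
  lem₂ = solve-∀
  lem₃ : ∀ r a s → r * (a * (s * s)) ≡ r * a * s * s
  lem₃ = solve-∀


-- Sums and products over ordered extensions of a set

private variable n : ℕ

-- ε is the value at the points x ∈ A: the unit of the sum or product taken over x ∉ A.
extend : ℕ → (Subset n → ℕ) → Subset n → Fin n → ℕ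
extend ε g A x = if lookup A x then ε else g (A [ x ]≔ inside)

𝔼 ℙ : (Subset n → ℕ) → Subset n → ℕ
𝔼 g A = ∑ (extend 0 g A)
ℙ g A = ∏ (extend 1 g A)

-- up k f A sums f over the ordered k-tuples of distinct points outside A, each added to A.
up up× : ℕ → (Subset n → ℕ) → Subset n → ℕ
up k f = fold f 𝔼 k
up× k f = fold f ℙ k

self : (Subset n → ℕ) → Subset n → ℕ
self f A = f A ^ f A

𝔼-mono : {f g : Subset n → ℕ} → (∀ A → f A ≤ g A) → ∀ A → 𝔼 f A ≤ 𝔼 g A
𝔼-mono {f = f} {g} f≤g A = ∑-mono pt
  where
  pt : ∀ x → extend 0 f A x ≤ extend 0 g A x
  pt x with lookup A x
  ... | true = ≤-refl
  ... | false = f≤g _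

ℙ-mono : {f g : Subset n → ℕ} → (∀ A → f A ≤ g A) → ∀ A → ℙ f A ≤ ℙ g A
ℙ-mono {f = f} {g} f≤g A = ∏-mono pt
  where
  pt : ∀ x → extend 1 f A x ≤ extend 1 g A x
  pt x with lookup A x
  ... | true = ≤-refl
  ... | false = f≤g _

up-mono : ∀ k {f g : Subset n → ℕ} → (∀ A → f A ≤ g A) → ∀ A → up k f A ≤ up k g A
up-mono zero f≤g = f≤g
up-mono (suc k) f≤g = 𝔼-mono (up-mono k f≤g)

up×-mono : ∀ k {f g : Subset n → ℕ} → (∀ A → f A ≤ g A) → ∀ A → up× k f A ≤ up× k g A
up×-mono zero f≤g = f≤g
up×-mono (suc k) f≤g = ℙ-mono (up×-mono k f≤g)

ℙ-cong : {f g : Subset n → ℕ} → (∀ A → f A ≡ g A) → ∀ A → ℙ f A ≡ ℙ g A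
ℙ-cong f≡g A = ≤-antisym (ℙ-mono (≤-reflexive ∘ f≡g) A) (ℙ-mono (≤-reflexive ∘ sym ∘ f≡g) A)

ℙ-* : ∀ (f g : Subset n → ℕ) A → ℙ (λ A → f A * g A) A ≡ ℙ f A * ℙ g A
ℙ-* f g A = trans (∏-cong pt) (∏-distrib (extend 1 f A) (extend 1 g A))
  where
  pt : ∀ x → extend 1 (λ A → f A * g A) A x ≡ extend 1 f A x * extend 1 g A x
  pt x with lookup A x
  ... | true = refl
  ... | false = refl

ℙ-^ : ∀ c (f : Subset n → ℕ) A → ℙ (λ A → c ^ f A) A ≡ c ^ 𝔼 f A
ℙ-^ c f A = trans (∏-cong pt) (∏-^ c (extend 0 f A))
  where
  pt : ∀ x → extend 1 (λ A → c ^ f A) A x ≡ c ^ extend 0 f A x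
  pt x with lookup A x
  ... | true = refl
  ... | false = refl

ℙ-self : ∀ (f : Subset n → ℕ) A x → extend 1 (self f) A x ≡ extend 0 f A x ^ extend 0 f A x
ℙ-self f A x with lookup A x
... | true = refl
... | false = refl

up×-* : ∀ k (f g : Subset n → ℕ) A → up× k (λ A → f A * g A) A ≡ up× k f A * up× k g A
up×-* zero f g A = refl
up×-* (suc k) f g A = trans (ℙ-cong (up×-* k f g) A) (ℙ-* (up× k f) (up× k g) A)

up×-^ : ∀ k c (f : Subset n → ℕ) A → up× k (λ A → c ^ f A) A ≡ c ^ up k f A
up×-^ zero c f A = refl
up×-^ (suc k) c f A = trans (ℙ-cong (up×-^ k c f) A) (ℙ-^ c (up k f) A)

-- The entropy of a j-tuple distributed according to f is at most the logarithm of the number of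
-- tuples g that may carry weight.
entropy≤support : ∀ j {f g : Subset n → ℕ} → (∀ A → NonZero (f A) → 1 ≤ g A) →
  ∀ A → self (up j f) A ≤ up× j (self f) A * up j g A ^ up j f A
entropy≤support zero {f} {g} f⇒g A with f A in eq
... | zero = ≤-refl
... | suc k = begin
  suc k ^ suc k                    ≡⟨ *-identityʳ _ ⟨
  suc k ^ suc k * 1                ≡⟨ cong (suc k ^ suc k *_) (^-zeroˡ (suc k)) ⟨
  suc k ^ suc k * 1 ^ suc k        ≤⟨ *-monoʳ-≤ (suc k ^ suc k) (^-monoˡ-≤ (suc k) (f⇒g A (subst NonZero (sym eq) _))) ⟩
  suc k ^ suc k * g A ^ suc k      ∎
  where open ≤-Reasoning
entropy≤support (suc j) {f} {g} f⇒g A = *-cancelˡ-≤ (P * Q) {{PQ≢0}} (begin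
  P * Q * S ^ S                ≡⟨ *-assoc P Q (S ^ S) ⟩
  P * (Q * S ^ S)              ≤⟨ *-mono-≤ P≤ (gibbs a b) ⟩
  Γ * Q * (P * ∑ b ^ S)        ≡⟨ lem Γ Q P (∑ b ^ S) ⟩
  P * Q * (Γ * ∑ b ^ S)        ∎)
  where
  open ≤-Reasoning
  a b : Fin _ → ℕ
  a = extend 0 (up j f) A
  b = extend 0 (up j g) A
  S = ∑ a
  P = ∏ (λ x → a x ^ a x)
  Q = ∏ (λ x → b x ^ a x)
  Γ = ℙ (up× j (self f)) A
  pt : ∀ x → a x ^ a x ≤ extend 1 (up× j (self f)) A x * b x ^ a x
  pt x with lookup A x
  ... | true = ≤-refl
  ... | false = entropy≤support j f⇒g _
  P≤ : P ≤ Γ * Q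
  P≤ = ≤-trans (∏-mono pt) (≤-reflexive (∏-distrib (extend 1 (up× j (self f)) A) (λ x → b x ^ a x)))
  P≢0 : NonZero P
  P≢0 = ∏≢0 (λ x → n^n≢0 (a x))
  -- The bases `b x` in `Q` may vanish, so positivity of `Q` is drawn from `P≤` and the positivity
  -- of `P`.
  PQ≢0 : NonZero (P * Q)
  PQ≢0 = m*n≢0 P Q {{P≢0}} {{m*n≢0⇒n≢0 Γ {{>-nonZero (≤-trans (>-nonZero⁻¹ P {{P≢0}}) P≤)}}}}
  lem : ∀ g q p s → g * q * (p * s) ≡ p * q * (g * s)
  lem = solve-∀

-- Families of sets

-- The joint weight of the next two points after `A`. It vanishes on the diagonal, because `x`
-- already lies in the set once it is added, so its support is a loopless graph on the complement of
-- `A`.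
codegree : (Subset n → ℕ) → Subset n → Fin n → Fin n → ℕ
codegree f A x y = extend 0 (λ A′ → extend 0 f A′ y) A x

codegree-sym : ∀ (f : Subset n → ℕ) A x y → codegree f A x y ≡ codegree f A y x
codegree-sym f A x y with x Fin.≟ y
... | yes refl = refl
... | no x≢y
  rewrite lookup∘updateAt′ y x {λ _ → inside} (x≢y ∘ sym) A | lookup∘updateAt′ x y {λ _ → inside} x≢y A
  with lookup A x | lookup A y
... | true | true = refl
... | true | false = refl
... | false | true = refl
... | false | false = cong f ([]≔-commutes A x y x≢y)

∑-codegree : ∀ (f : Subset n → ℕ) A x → ∑ (codegree f A x) ≡ extend 0 (𝔼 f) A x
∑-codegree {n} f A x with lookup A x
... | true = ∑≡0 {n} {λ _ → 0} λ _ → refl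
... | false = refl

ℙℙ-self : ∀ (f : Subset n → ℕ) A →
  ∏ (λ x → ∏ (λ y → codegree f A x y ^ codegree f A x y)) ≡ ℙ (ℙ (self f)) A
ℙℙ-self {n} f A = ∏-cong pt
  where
  pt : ∀ x → ∏ (λ y → codegree f A x y ^ codegree f A x y) ≡ extend 1 (ℙ (self f)) A x
  pt x with lookup A x
  ... | true = ∏≡1 {n} {λ _ → 1} λ _ → refl
  ... | false = ∏-cong λ y → sym (ℙ-self f (A [ x ]≔ inside) y)

entropy-turán-link : ∀ m (f : Subset n → ℕ) A →
  (∀ xs → Clique (λ x y → 0 <ᵇ codegree f A x y) xs → length xs ≢ suc (suc m)) →
  ℙ (self (𝔼 f)) A * ℙ (self (𝔼 f)) A * suc m ^ 𝔼 (𝔼 f) A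
    ≤ ℙ (ℙ (self f)) A * m ^ 𝔼 (𝔼 f) A * self (𝔼 (𝔼 f)) A
entropy-turán-link m f A free =
  subst₂ (λ P S → P * P * suc m ^ S ≤ ℙ (ℙ (self f)) A * m ^ S * S ^ S)
    (∏-cong λ x → trans (cong₂ _^_ (∑-codegree f A x) (∑-codegree f A x)) (sym (ℙ-self (𝔼 f) A x)))
    (∑-cong (∑-codegree f A))
    (subst (λ R → P * P * suc m ^ S ≤ R * m ^ S * S ^ S) (ℙℙ-self f A)
      (entropy-turán m (codegree f A) (codegree-sym f A) free))
  where
  S = ∑ (λ x → ∑ (codegree f A x))
  P = ∏ (λ x → ∑ (codegree f A x) ^ ∑ (codegree f A x))

up×-ℙ : ∀ j (f : Subset n → ℕ) → up× j (ℙ f) ≡ ℙ (up× j f)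
up×-ℙ zero f = refl
up×-ℙ (suc j) f = cong ℙ (up×-ℙ j f)

-- If (X₁ , … , X_p) is uniform on the orderings of the sets in a p-uniform family F and N is their number,
-- then potential F j k is N ^ N divided by the exponential of N H(X₁ , … , X_j), where j + k = p.
potential : (Subset n → ℕ) → ℕ → ℕ → ℕ
potential F j k = up× j (self (up k F)) ∅

-- The link inequality is multiplied over all ordered `j`-tuples; the exponents, the numbers of
-- completions, add up to `N`.
potential-concave : ∀ (F : Subset n → ℕ) j k m →
  (∀ A xs → Clique (λ x y → 0 <ᵇ codegree (up k F) A x y) xs → length xs ≢ suc (suc m)) →
  let N = up (j + suc (suc k)) F ∅ in
  potential F (suc j) (suc k) * potential F (suc j) (suc k) * suc m ^ N
    ≤ potential F (suc (suc j)) k * m ^ N * potential F j (suc (suc k))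
potential-concave F j k m free = subst₂ _≤_ lhs rhs
  (up×-mono j (λ A → entropy-turán-link m (up k F) A (free A)) ∅)
  where
  open ≡-Reasoning
  g = up (suc (suc k)) F
  G : Subset _ → ℕ
  G = self (up (suc k) F)
  N = up (j + suc (suc k)) F ∅
  up×-^N : ∀ c → up× j (λ A → c ^ g A) ∅ ≡ c ^ N
  up×-^N c = trans (up×-^ j c g ∅) (cong (λ h → c ^ h ∅) (sym (fold-+ F 𝔼 j)))
  lhs : up× j (λ A → ℙ G A * ℙ G A * suc m ^ g A) ∅ ≡ potential F (suc j) (suc k) * potential F (suc j) (suc k) * suc m ^ N
  lhs = begin
    up× j (λ A → ℙ G A * ℙ G A * suc m ^ g A) ∅
      ≡⟨ up×-* j (λ A → ℙ G A * ℙ G A) (λ A → suc m ^ g A) ∅ ⟩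
    up× j (λ A → ℙ G A * ℙ G A) ∅ * up× j (λ A → suc m ^ g A) ∅
      ≡⟨ cong₂ _*_ (up×-* j (ℙ G) (ℙ G) ∅) (up×-^N (suc m)) ⟩
    up× j (ℙ G) ∅ * up× j (ℙ G) ∅ * suc m ^ N
      ≡⟨ cong (λ h → h ∅ * h ∅ * suc m ^ N) (up×-ℙ j G) ⟩
    potential F (suc j) (suc k) * potential F (suc j) (suc k) * suc m ^ N ∎
  H : Subset _ → ℕ
  H = self (up k F)
  rhs : up× j (λ A → ℙ (ℙ H) A * m ^ g A * self g A) ∅ ≡ potential F (suc (suc j)) k * m ^ N * potential F j (suc (suc k))
  rhs = begin
    up× j (λ A → ℙ (ℙ H) A * m ^ g A * self g A) ∅
      ≡⟨ up×-* j (λ A → ℙ (ℙ H) A * m ^ g A) (self g) ∅ ⟩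
    up× j (λ A → ℙ (ℙ H) A * m ^ g A) ∅ * up× j (self g) ∅
      ≡⟨ cong (_* up× j (self g) ∅) (up×-* j (ℙ (ℙ H)) (λ A → m ^ g A) ∅) ⟩
    up× j (ℙ (ℙ H)) ∅ * up× j (λ A → m ^ g A) ∅ * up× j (self g) ∅
      ≡⟨ cong₂ (λ h z → h ∅ * z * up× j (self g) ∅) (trans (up×-ℙ j (ℙ H)) (cong ℙ (up×-ℙ j H))) (up×-^N m) ⟩
    potential F (suc (suc j)) k * m ^ N * potential F j (suc (suc k)) ∎

∑≢0⇒∃ : (f : Fin n → ℕ) → NonZero (∑ f) → ∃ λ x → NonZero (f x)
∑≢0⇒∃ {suc n} f nz with f zero in eq
... | suc _ = zero , subst NonZero (sym eq) _
... | zero = map suc (λ z → z) (∑≢0⇒∃ (f ∘ suc) nz)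

⊆-insert : ∀ (A : Subset n) x → A ⊆ A [ x ]≔ inside
⊆-insert A x {y} y∈A with y Fin.≟ x
... | yes refl = []≔-updates A x
... | no y≢x = []≔-minimal A y x y≢x y∈A

∈-insert⁻ : ∀ (A : Subset n) x {y} → y ∈ A [ x ]≔ inside → y ≡ x ⊎ y ∈ A
∈-insert⁻ A x {y} y∈ with y Fin.≟ x
... | yes y≡x = inj₁ y≡x
... | no y≢x = inj₂ (lookup⇒[]= y A (trans (sym (lookup∘updateAt′ y x y≢x A)) ([]=⇒lookup y∈)))

∣insert∣ : ∀ (A : Subset n) x → lookup A x ≡ false → ∣ A [ x ]≔ inside ∣ ≡ suc ∣ A ∣
∣insert∣ (false ∷ A) zero eq = refl
∣insert∣ (true ∷ A) (suc x) eq = cong suc (∣insert∣ A x eq)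
∣insert∣ (false ∷ A) (suc x) eq = ∣insert∣ A x eq

lookup≡false⇒∉ : ∀ {A : Subset n} {x} → lookup A x ≡ false → x ∉ A
lookup≡false⇒∉ {A = A} {x} eq x∈A with trans (sym ([]=⇒lookup x∈A)) eq
... | ()

∉⇒lookup≡false : ∀ {A : Subset n} {x} → x ∉ A → lookup A x ≡ false
∉⇒lookup≡false {A = A} {x} x∉A with lookup A x in eq
... | true = ⊥-elim (x∉A (lookup⇒[]= x A eq))
... | false = refl

extend≢0⇒∉ : ∀ (f : Subset n → ℕ) A x → NonZero (extend 0 f A x) →
  lookup A x ≡ false × NonZero (f (A [ x ]≔ inside))
extend≢0⇒∉ f A x nz with lookup A x
... | false = refl , nz

up≢0⇒∃ : ∀ k (F : Subset n → ℕ) A → NonZero (up k F A) →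
  ∃ λ B → NonZero (F B) × A ⊆ B × ∣ B ∣ ≡ k + ∣ A ∣
up≢0⇒∃ zero F A nz = A , nz , (λ z → z) , refl
up≢0⇒∃ (suc k) F A nz with ∑≢0⇒∃ (extend 0 (up k F) A) nz
... | x , nz′ with extend≢0⇒∉ (up k F) A x nz′
... | x∉A , nz″ with up≢0⇒∃ k F (A [ x ]≔ inside) nz″
... | B , FB , A∪x⊆B , ∣B∣ = B , FB , A∪x⊆B ∘ ⊆-insert A x ,
  trans ∣B∣ (trans (cong (k +_) (∣insert∣ A x x∉A)) (+-suc k ∣ A ∣))

codegree≢0⇒ : ∀ k (F : Subset n → ℕ) A x y → NonZero (codegree (up k F) A x y) →
  x ≢ y × x ∉ A × y ∉ A ×
    ∃ λ B → NonZero (F B) × A ⊆ B × x ∈ B × y ∈ B × ∣ B ∣ ≡ k + suc (suc ∣ A ∣)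
codegree≢0⇒ k F A x y nz with extend≢0⇒∉ (λ A′ → extend 0 (up k F) A′ y) A x nz
... | x∉A , nz′ with extend≢0⇒∉ (up k F) (A [ x ]≔ inside) y nz′
... | y∉A∪x , nz″ with up≢0⇒∃ k F _ nz″
... | B , FB , ⊆B , ∣B∣ =
  (λ { refl → lookup≡false⇒∉ y∉A∪x ([]≔-updates A x) }) , lookup≡false⇒∉ x∉A ,
  lookup≡false⇒∉ y∉A∪x ∘ ⊆-insert A x ,
  B , FB , ⊆B ∘ ⊆-insert _ y ∘ ⊆-insert A x , ⊆B (⊆-insert _ y ([]≔-updates A x)) , ⊆B ([]≔-updates _ y) ,
  trans ∣B∣ (cong (k +_) (trans (∣insert∣ (A [ x ]≔ inside) y y∉A∪x) (cong suc (∣insert∣ A x x∉A))))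

elements : Subset n → List (Fin n)
elements [] = []
elements (true ∷ A) = zero ∷ List.map suc (elements A)
elements (false ∷ A) = List.map suc (elements A)

length-elements : ∀ (A : Subset n) → length (elements A) ≡ ∣ A ∣
length-elements [] = refl
length-elements (true ∷ A) = cong suc (trans (List.length-map suc (elements A)) (length-elements A))
length-elements (false ∷ A) = trans (List.length-map suc (elements A)) (length-elements A)

elements⊆ : ∀ (A : Subset n) → All (_∈ A) (elements A)
elements⊆ [] = []
elements⊆ (true ∷ A) = here ∷ All.map⁺ (All.map there (elements⊆ A))
elements⊆ (false ∷ A) = All.map⁺ (All.map there (elements⊆ A))

elements-unique : ∀ (A : Subset n) → AllPairs _≢_ (elements A)
elements-unique [] = []
elements-unique (true ∷ A) = All.map⁺ (All.universal (λ _ ()) (elements A)) ∷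
  AllPairs.map⁺ (AllPairs.map (_∘ Fin.suc-injective) (elements-unique A))
elements-unique (false ∷ A) = AllPairs.map⁺ (AllPairs.map (_∘ Fin.suc-injective) (elements-unique A))

-- Distinctness is built in, so that a list of pairwise linked points has no repetitions and its
-- length is the size of a set.
Linked : (Subset n → Set) → Fin n → Fin n → Set
Linked P u v = u ≢ v × ∃ λ B → P B × u ∈ B × v ∈ B

-- A clique of the link of A, together with A itself, is pairwise covered.
link-clique-free : ∀ {e p} k (F : Subset n → ℕ) → (∀ B → NonZero (F B) → ∣ B ∣ ≡ p) →
  (∀ xs → AllPairs (Linked (NonZero ∘ F)) xs → length xs ≢ suc (e + p)) →
  ∀ A xs → Clique (λ x y → 0 <ᵇ codegree (up k F) A x y) xs → length xs ≢ suc (suc (suc (e + k)))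
link-clique-free {e = e} {p} k F unif free A xs@(x ∷ y ∷ ys) clique@((xy ∷ _) ∷ _) eq =
  free (xs ++ elements A) pairs (begin
    length (xs ++ elements A)              ≡⟨ List.length-++ xs ⟩
    length xs + length (elements A)        ≡⟨ cong₂ _+_ eq (length-elements A) ⟩
    -- `A` has p - k - 2 points, hence the union has e + p + 1, which is ℓ + 1 for e = ℓ - p.
    suc (suc (suc (e + k))) + ∣ A ∣        ≡⟨ lem e k ∣ A ∣ ⟩
    suc (e + (k + suc (suc ∣ A ∣)))        ≡⟨ cong (λ z → suc (e + z)) ∣B₀∣ ⟩
    suc (e + p)                            ∎)
  where
  open ≡-Reasoning
  lem : ∀ e k a → suc (suc (suc (e + k))) + a ≡ suc (e + (k + suc (suc a)))
  lem = solve-∀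
  Attached : Fin _ → Set
  Attached x = x ∉ A × ∃ λ B → NonZero (F B) × A ⊆ B × x ∈ B

  joined : ∀ {x y} → T (0 <ᵇ codegree (up k F) A x y) → Linked (NonZero ∘ F) x y × Attached x × Attached y
  joined {x} {y} t with codegree≢0⇒ k F A x y (>-nonZero (<ᵇ⇒< 0 _ t))
  ... | x≢y , x∉A , y∉A , B , FB , A⊆B , x∈B , y∈B , _ =
    (x≢y , B , FB , x∈B , y∈B) , (x∉A , B , FB , A⊆B , x∈B) , (y∉A , B , FB , A⊆B , y∈B)

  -- One edge of the clique already supplies a member of the family around `A`; it fixes the size of
  -- `A` and covers the pairs inside `A`.
  base : ∃ λ B → NonZero (F B) × A ⊆ B × ∣ B ∣ ≡ k + suc (suc ∣ A ∣)
  base with codegree≢0⇒ k F A x y (>-nonZero (<ᵇ⇒< 0 _ xy))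
  ... | _ , _ , _ , B , FB , A⊆B , _ , _ , ∣B∣ = B , FB , A⊆B , ∣B∣
  ∣B₀∣ : k + suc (suc ∣ A ∣) ≡ p
  ∣B₀∣ with base
  ... | B , FB , _ , ∣B∣ = trans (sym ∣B∣) (unif B FB)

  attached : All Attached xs
  attached = proj₁ (proj₂ (joined xy)) ∷ All.map (λ t → proj₂ (proj₂ (joined t))) (AllPairs.head clique)

  within : ∀ {us} → All (_∈ A) us → AllPairs _≢_ us → AllPairs (Linked (NonZero ∘ F)) us
  within [] [] = []
  within (u∈A ∷ us∈A) (u≢us ∷ us!) with base
  ... | B , FB , A⊆B , _ =
    All.zipWith (λ { (v∈A , u≢v) → u≢v , B , FB , A⊆B u∈A , A⊆B v∈A }) (us∈A , u≢us) ∷ within us∈A us!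

  pairs : AllPairs (Linked (NonZero ∘ F)) (xs ++ elements A)
  pairs = AllPairs.++⁺ (AllPairs.map (λ t → proj₁ (joined t)) clique) (within (elements⊆ A) (elements-unique A))
    (All.map (λ { (x∉A , B , FB , A⊆B , x∈B) →
      All.map (λ u∈A → (λ { refl → x∉A u∈A }) , B , FB , x∈B , A⊆B u∈A) (elements⊆ A) }) attached)
link-clique-free k F unif free A [] clique ()
link-clique-free k F unif free A (x ∷ []) clique ()

-- Counting sets and forbidden configurations

total : ∀ {n} → (Subset n → ℕ) → ℕ
total {zero} f = f []
total {suc n} f = total (f ∘ (inside ∷_)) + total (f ∘ (outside ∷_))

total-mono : {f g : Subset n → ℕ} → (∀ A → f A ≤ g A) → total f ≤ total g
total-mono {zero} f≤g = f≤g []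
total-mono {suc n} f≤g = +-mono-≤ (total-mono (f≤g ∘ (inside ∷_))) (total-mono (f≤g ∘ (outside ∷_)))

total-cong : {f g : Subset n → ℕ} → (∀ A → f A ≡ g A) → total f ≡ total g
total-cong f≡g = ≤-antisym (total-mono (≤-reflexive ∘ f≡g)) (total-mono (≤-reflexive ∘ sym ∘ f≡g))

total-+ : (f g : Subset n → ℕ) → total (λ A → f A + g A) ≡ total f + total g
total-+ {zero} f g = refl
total-+ {suc n} f g
  rewrite total-+ (f ∘ (inside ∷_)) (g ∘ (inside ∷_)) | total-+ (f ∘ (outside ∷_)) (g ∘ (outside ∷_)) =
  lem (total (f ∘ (inside ∷_))) (total (g ∘ (inside ∷_))) (total (f ∘ (outside ∷_))) (total (g ∘ (outside ∷_)))
  where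
  lem : ∀ a b c d → a + b + (c + d) ≡ a + c + (b + d)
  lem = solve-∀

total-* : ∀ c (f : Subset n → ℕ) → total (λ A → c * f A) ≡ c * total f
total-* {zero} c f = refl
total-* {suc n} c f = trans (cong₂ _+_ (total-* c (f ∘ (inside ∷_))) (total-* c (f ∘ (outside ∷_))))
  (sym (*-distribˡ-+ c (total (f ∘ (inside ∷_))) (total (f ∘ (outside ∷_)))))

total-0 : total {n} (λ _ → 0) ≡ 0
total-0 {n} = total-* {n} 0 (λ _ → 0)

total-single : ∀ (f : Subset n → ℕ) B → (∀ A → A ≢ B → f A ≡ 0) → total f ≡ f B
total-single f [] f≡0 = refl
total-single {suc n} f (true ∷ B) f≡0 = trans (cong₂ _+_
  (total-single (f ∘ (inside ∷_)) B (λ A A≢B → f≡0 _ λ { refl → A≢B refl }))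
  (trans (total-cong (λ A → f≡0 (outside ∷ A) λ ())) (total-0 {n}))) (+-identityʳ _)
total-single {suc n} f (false ∷ B) f≡0 = cong₂ _+_
  (trans (total-cong (λ A → f≡0 (inside ∷ A) λ ())) (total-0 {n}))
  (total-single (f ∘ (outside ∷_)) B (λ A A≢B → f≡0 _ λ { refl → A≢B refl }))

indicator : {P : Pred (Subset n) 0ℓ} → Decidable P → Subset n → ℕ
indicator P? A = ⟦ does (P? A) ⟧

countSub≡total : {P : Pred (Subset n) 0ℓ} (P? : Decidable P) → countSub n P? ≡ total (indicator P?)
countSub≡total {zero} P? with does (P? [])
... | true = refl
... | false = refl
countSub≡total {suc n} P? = cong₂ _+_ (countSub≡total (P? ∘ (inside ∷_))) (countSub≡total (P? ∘ (outside ∷_)))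

⟦does⟧≢0 : {P : Set} (P? : Dec P) → NonZero ⟦ does P? ⟧ → P
⟦does⟧≢0 (yes p) _ = p

⟦does⟧≡1 : {P : Set} (P? : Dec P) → P → ⟦ does P? ⟧ ≡ 1
⟦does⟧≡1 P? p = cong ⟦_⟧ (dec-true P? p)

⟦does⟧≤ : {P : Set} (P? : Dec P) {m : ℕ} → (P → 1 ≤ m) → ⟦ does P? ⟧ ≤ m
⟦does⟧≤ (yes p) 1≤m = 1≤m p
⟦does⟧≤ (no _) _ = z≤n

-- Each set B arises from ∣ B ∣ pairs (A , x) with x ∉ A and A ∪ {x} = B.
total-𝔼 : (f : Subset n → ℕ) → total (𝔼 f) ≡ total (λ A → ∣ A ∣ * f A)
total-𝔼 {zero} f = refl
total-𝔼 {suc n} f = begin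
  total (𝔼 fᵢ) + total (λ A → fᵢ A + 𝔼 fₒ A)
    ≡⟨ cong₂ _+_ (total-𝔼 fᵢ) (trans (total-+ fᵢ (𝔼 fₒ)) (cong (total fᵢ +_) (total-𝔼 fₒ))) ⟩
  total (λ A → ∣ A ∣ * fᵢ A) + (total fᵢ + total (λ A → ∣ A ∣ * fₒ A))
    ≡⟨ lem (total (λ A → ∣ A ∣ * fᵢ A)) (total fᵢ) (total (λ A → ∣ A ∣ * fₒ A)) ⟩
  total fᵢ + total (λ A → ∣ A ∣ * fᵢ A) + total (λ A → ∣ A ∣ * fₒ A)
    ≡⟨ cong (_+ total (λ A → ∣ A ∣ * fₒ A)) (total-+ fᵢ (λ A → ∣ A ∣ * fᵢ A)) ⟨
  total (λ A → fᵢ A + ∣ A ∣ * fᵢ A) + total (λ A → ∣ A ∣ * fₒ A) ∎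
  where
  open ≡-Reasoning
  fᵢ fₒ : Subset n → ℕ
  fᵢ A = f (inside ∷ A)
  fₒ A = f (outside ∷ A)
  lem : ∀ a b c → a + (b + c) ≡ b + a + c
  lem = solve-∀

∣A∣≡0⇒A≡∅ : ∀ {A : Subset n} → ∣ A ∣ ≡ 0 → A ≡ ∅
∣A∣≡0⇒A≡∅ {A = []} eq = refl
∣A∣≡0⇒A≡∅ {A = false ∷ A} eq = cong (false ∷_) (∣A∣≡0⇒A≡∅ eq)

module _ {n p : ℕ} (F : Subset n → ℕ) (unif : ∀ B → NonZero (F B) → ∣ B ∣ ≡ p) where

  up-uniform : ∀ k A → NonZero (up k F A) → k + ∣ A ∣ ≡ p
  up-uniform k A nz with up≢0⇒∃ k F A nz
  ... | B , FB , _ , ∣B∣ = trans (sym ∣B∣) (unif B FB)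

  -- Double counting: `up k F` lives on sets of size `j`, so each application of `𝔼` that is removed
  -- contributes the factor `suc j`.
  total-up : ∀ k j → j + k ≡ p → total (up k F) * j ! ≡ p ! * total F
  total-up zero j eq with refl ← trans (sym (+-identityʳ j)) eq = *-comm (total F) (j !)
  total-up (suc k) j eq = begin
    total (𝔼 (up k F)) * j !             ≡⟨ cong (_* j !) (trans (total-𝔼 (up k F)) (total-cong scale)) ⟩
    total (λ A → suc j * up k F A) * j ! ≡⟨ cong (_* j !) (total-* (suc j) (up k F)) ⟩
    suc j * total (up k F) * j !         ≡⟨ lem j (total (up k F)) (j !) ⟩
    total (up k F) * suc j !             ≡⟨ total-up k (suc j) (trans (sym (+-suc j k)) eq) ⟩
    p ! * total F                        ∎
    where
    open ≡-Reasoning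
    lem : ∀ j t f → suc j * t * f ≡ t * (suc j * f)
    lem = solve-∀
    scale : ∀ A → ∣ A ∣ * up k F A ≡ suc j * up k F A
    scale A with up k F A in eqA
    ... | zero = trans (*-zeroʳ ∣ A ∣) (sym (*-zeroʳ (suc j)))
    ... | suc m = cong (_* suc m) (+-cancelˡ-≡ k _ _
      (trans (up-uniform k A (subst NonZero (sym eqA) _)) (trans (sym eq) (trans (+-suc j k) (+-comm (suc j) k)))))

  -- Only the empty set extends by `p` new points to a `p`-set, so the total collapses to one value.
  up-∅ : up p F ∅ ≡ p ! * total F
  up-∅ = trans (sym (total-single (up p F) ∅ off)) (trans (sym (*-identityʳ _)) (total-up p 0 refl))
    where
    off : ∀ A → A ≢ ∅ → up p F A ≡ 0
    off A A≢∅ with up p F A in eqA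
    ... | zero = refl
    ... | suc _ = ⊥-elim (A≢∅ (∣A∣≡0⇒A≡∅ (+-cancelˡ-≡ p _ _
      (trans (up-uniform p A (subst NonZero (sym eqA) _)) (sym (+-identityʳ p))))))

-- Pairwise covered sets and the forbidden family

_≟ˢ_ : (A B : Subset n) → Dec (A ≡ B)
_≟ˢ_ = ≡-dec Bool._≟_

module _ {n : ℕ} where
  open DecMembership (_≟ˢ_ {n}) public using () renaming (_∈?_ to _∈ˡ?_)

-- Only an inequality, since an edge that covers several pairs is listed several times; the
-- forbidden family asks for an upper bound on the number of edges.
count-list : ∀ (Bs : List (Subset n)) → total (indicator (_∈ˡ? Bs)) ≤ length Bs
count-list {n} [] = ≤-reflexive (total-0 {n})
count-list (B ∷ Bs) = begin
  total (indicator (_∈ˡ? (B ∷ Bs)))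
    ≤⟨ total-mono (λ A → ⟦does⟧≤ (A ∈ˡ? (B ∷ Bs)) (split A)) ⟩
  total (λ A → ⟦ does (A ≟ˢ B) ⟧ + indicator (_∈ˡ? Bs) A)
    ≡⟨ total-+ (λ A → ⟦ does (A ≟ˢ B) ⟧) (indicator (_∈ˡ? Bs)) ⟩
  total (λ A → ⟦ does (A ≟ˢ B) ⟧) + total (indicator (_∈ˡ? Bs))
    ≡⟨ cong (_+ total (indicator (_∈ˡ? Bs))) single ⟩
  suc (total (indicator (_∈ˡ? Bs)))
    ≤⟨ s≤s (count-list Bs) ⟩
  suc (length Bs) ∎
  where
  open ≤-Reasoning
  split : ∀ A → A List.∈ (B ∷ Bs) → 1 ≤ ⟦ does (A ≟ˢ B) ⟧ + indicator (_∈ˡ? Bs) A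
  split A (here A≡B) = ≤-trans (≤-reflexive (sym (⟦does⟧≡1 (A ≟ˢ B) A≡B))) (m≤m+n _ _)
  split A (there A∈) = ≤-trans (≤-reflexive (sym (⟦does⟧≡1 (A ∈ˡ? Bs) A∈))) (m≤n+m _ _)
  single : total (λ A → ⟦ does (A ≟ˢ B) ⟧) ≡ 1
  single = trans (total-single _ B (λ A A≢B → cong ⟦_⟧ (dec-false (A ≟ˢ B) A≢B))) (⟦does⟧≡1 (B ≟ˢ B) refl)

image-id : ∀ (B : Subset n) → image id B ≡ B
image-id B = trans (tabulate-cong pt) (tabulate∘lookup B)
  where
  at : ∀ y x → Dec (x ∈ B × x ≡ y)
  at y x = (x ∈? B) ×-dec (x Fin.≟ y)
  pt : ∀ y → does (Fin.any? (at y)) ≡ lookup B y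
  pt y with y ∈? B
  ... | yes y∈B = trans (dec-true (Fin.any? (at y)) (y , y∈B , refl)) (sym ([]=⇒lookup y∈B))
  ... | no y∉B = trans (dec-false (Fin.any? (at y)) (λ { (_ , x∈B , refl) → y∉B x∈B })) (sym (∉⇒lookup≡false y∉B))

Together : List (Subset n) → Fin n → Fin n → Set
Together Bs u v = Any (λ B → u ∈ B × v ∈ B) Bs

AllPairs-lookup : ∀ {A : Set} {R : A → A → Set} → (∀ {x y} → R x y → R y x) →
  ∀ {xs} → AllPairs R xs → ∀ {u v} → u List.∈ xs → v List.∈ xs → u ≢ v → R u v
AllPairs-lookup R-sym (_ ∷ _) (here refl) (here refl) u≢v = ⊥-elim (u≢v refl)
AllPairs-lookup R-sym (Rx ∷ _) (here refl) (there v∈) _ = All.lookup Rx v∈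
AllPairs-lookup R-sym (Rx ∷ _) (there u∈) (here refl) _ = R-sym (All.lookup Rx u∈)
AllPairs-lookup R-sym (_ ∷ Rxs) (there u∈) (there v∈) u≢v = AllPairs-lookup R-sym Rxs u∈ v∈ u≢v

module _ {n : ℕ} {P : Subset n → Set} where

  cover-star : ∀ {u xs} → All (Linked P u) xs →
    ∃ λ Bs → length Bs ≡ length xs × All P Bs × All (Together Bs u) xs
  cover-star [] = [] , refl , [] , []
  cover-star ((_ , B , PB , u∈B , v∈B) ∷ links) with cover-star links
  ... | Bs , len , PBs , tog = B ∷ Bs , cong suc len , PB ∷ PBs , here (u∈B , v∈B) ∷ All.map there tog

  -- Peeling off a vertex costs one edge for each remaining vertex, which is Pascal's rule for
  -- `C 2`.
  cover-pairs : ∀ {xs} → AllPairs (Linked P) xs →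
    ∃ λ Bs → length Bs ≡ length xs C 2 × All P Bs × AllPairs (Together Bs) xs
  cover-pairs [] = [] , refl , [] , []
  cover-pairs {x ∷ xs} (link ∷ links) with cover-star link | cover-pairs links
  ... | Bs , len , PBs , tog | Bs′ , len′ , PBs′ , tog′ =
    Bs ++ Bs′ ,
    trans (List.length-++ Bs) (trans (cong₂ _+_ (trans len (sym (nC1≡n (length xs)))) len′)
      (nCk+nC[k+1]≡[n+1]C[k+1] (length xs) 1)) ,
    All.++⁺ PBs PBs′ ,
    All.map Any.++⁺ˡ tog ∷ AllPairs.map (Any.++⁺ʳ Bs) tog′

fromList : List (Fin n) → Subset n
fromList = foldr (λ x A → A [ x ]≔ inside) ∅

∈-fromList⁻ : ∀ xs {y : Fin n} → y ∈ fromList xs → y List.∈ xs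
∈-fromList⁻ [] y∈ = ⊥-elim (∉⊥ y∈)
∈-fromList⁻ (x ∷ xs) y∈ with ∈-insert⁻ (fromList xs) x y∈
... | inj₁ y≡x = here y≡x
... | inj₂ y∈xs = there (∈-fromList⁻ xs y∈xs)

∣fromList∣ : ∀ {xs : List (Fin n)} → AllPairs _≢_ xs → ∣ fromList xs ∣ ≡ length xs
∣fromList∣ {n} [] = ∣⊥∣≡0 n
∣fromList∣ {xs = x ∷ xs} (x≢xs ∷ xs!) = trans
  (∣insert∣ (fromList xs) x (∉⇒lookup≡false (λ x∈ → All.lookup x≢xs (∈-fromList⁻ xs x∈) refl)))
  (cong suc (∣fromList∣ xs!))

-- The edges chosen to cover the pairs of xs form a member of K_{ℓ+1}^r on the same vertex set.
KFree⇒linked-free : ∀ {ℓ r} (H : RGraph n r) → KFree ℓ H →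
  ∀ xs → AllPairs (Linked (Edge H)) xs → length xs ≢ suc ℓ
KFree⇒linked-free {n} {ℓ} {r} H free xs links len with cover-pairs links
... | Bs , lenBs , EBs , tog = free n G inK (id , id , λ B B∈ → subst (Edge H) (sym (image-id B)) (All.lookup EBs B∈))
  where
  G : RGraph n r
  G = record { Edge = List._∈ Bs ; edge? = _∈ˡ? Bs ; uniform = λ B∈ → uniform H (All.lookup EBs B∈) }
  inK : InK ℓ G
  inK = ≤-trans (≤-reflexive (countSub≡total (_∈ˡ? Bs)))
          (≤-trans (count-list Bs) (≤-reflexive (trans lenBs (cong (_C 2) len)))) ,
        fromList xs , trans (∣fromList∣ (AllPairs.map proj₁ links)) len ,
        λ u v u∈ v∈ u≢v → let B , B∈ , u∈B , v∈B = find (AllPairs-lookup (Any.map swap) tog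
                                (∈-fromList⁻ xs u∈) (∈-fromList⁻ xs v∈) u≢v)
                          in B , B∈ , u∈B , v∈B

interpolate : ∀ r {X B : Subset n} → X ⊆ B → ∣ X ∣ ≤ r → r ≤ ∣ B ∣ → ∃ λ C → X ⊆ C × C ⊆ B × ∣ C ∣ ≡ r
interpolate zero {[]} {[]} _ _ _ = [] , ⊆-refl , ⊆-refl , refl
interpolate r {true ∷ X} {false ∷ B} X⊆B _ _ with () ← X⊆B here
interpolate (suc r) {true ∷ X} {true ∷ B} X⊆B (s≤s X≤r) (s≤s r≤B)
  with C , X⊆C , C⊆B , ∣C∣ ← interpolate r (drop-∷-⊆ X⊆B) X≤r r≤B =
  true ∷ C , s⊆s X⊆C , s⊆s C⊆B , cong suc ∣C∣
interpolate r {false ∷ X} {false ∷ B} X⊆B X≤r r≤B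
  with C , X⊆C , C⊆B , ∣C∣ ← interpolate r (drop-∷-⊆ X⊆B) X≤r r≤B =
  false ∷ C , s⊆s X⊆C , s⊆s C⊆B , ∣C∣
-- An optional point is dropped while the rest of `B` still has `r` elements; otherwise all of `B`
-- is needed and has exactly `r`.
interpolate r {false ∷ X} {true ∷ B} X⊆B X≤r r≤B with r ≤? ∣ B ∣
... | yes r≤B′ with C , X⊆C , C⊆B , ∣C∣ ← interpolate r (drop-∷-⊆ X⊆B) X≤r r≤B′ =
  false ∷ C , s⊆s X⊆C , out⊆ C⊆B , ∣C∣
... | no r≰B′ = true ∷ B , X⊆B , ⊆-refl , ≤-antisym (≰⇒> r≰B′) r≤B

-- The entropy increments combined

-- This is (e + k + 1)! / (e + 1)!, the product of the numerators in the ratios (e + 1 + i) / (e +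
-- 1) for i from 1 to k.
rising : ℕ → ℕ → ℕ
rising e zero = 1
rising e (suc k) = suc (suc (e + k)) * rising e k

rising-! : ∀ e k → rising e k * suc e ! ≡ (e + suc k) !
rising-! e zero = trans (+-identityʳ _) (cong _! (sym (+-comm e 1)))
rising-! e (suc k) = begin
  suc (suc (e + k)) * rising e k * suc e !   ≡⟨ *-assoc (suc (suc (e + k))) (rising e k) (suc e !) ⟩
  suc (suc (e + k)) * (rising e k * suc e !) ≡⟨ cong (suc (suc (e + k)) *_) (rising-! e k) ⟩
  suc (suc (e + k)) * (e + suc k) !          ≡⟨ cong (λ z → suc (suc (e + k)) * z !) (+-suc e k) ⟩
  suc (suc (e + k)) !                        ≡⟨ cong _! (trans (+-suc e (suc k)) (cong suc (+-suc e k))) ⟨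
  (e + suc (suc k)) !                        ∎
  where open ≡-Reasoning

C-! : ∀ e k → ((e + k) C k) * k ! * e ! ≡ (e + k) !
C-! e k = begin
  ((e + k) C k) * k ! * e !             ≡⟨ *-assoc ((e + k) C k) (k !) (e !) ⟩
  ((e + k) C k) * (k ! * e !)           ≡⟨ cong (λ z → ((e + k) C k) * (k ! * z !)) (m+n∸n≡m e k) ⟨
  ((e + k) C k) * (k ! * (e + k ∸ k) !) ≡⟨ cong (_* (k ! * (e + k ∸ k) !)) (nCk≡n!/k![n-k]! (m≤n+m k e)) ⟩
  _                                     ≡⟨ m/n*n≡m {{k !* (e + k ∸ k) !≢0}} (k![n∸k]!∣n! (m≤n+m k e)) ⟩
  (e + k) !                             ∎
  where open ≡-Reasoning

C-rising : ∀ e q → ((e + suc q) C q) * q ! ≡ rising e q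
C-rising e q = *-cancelʳ-≡ _ _ (suc e !) {{(suc e) !≢0}} (begin
  ((e + suc q) C q) * q ! * suc e !  ≡⟨ cong (λ z → (z C q) * q ! * suc e !) (+-suc e q) ⟩
  ((suc e + q) C q) * q ! * suc e !  ≡⟨ C-! (suc e) q ⟩
  (suc e + q) !                      ≡⟨ cong _! (+-suc e q) ⟨
  (e + suc q) !                      ≡⟨ rising-! e q ⟨
  rising e q * suc e !               ∎)
  where open ≡-Reasoning

C-rising-suc : ∀ e q → ((e + suc q) C suc q) * suc q ! ≡ rising e q * suc e
C-rising-suc e q = *-cancelʳ-≡ _ _ (e !) {{e !≢0}} (begin
  ((e + suc q) C suc q) * suc q ! * e ! ≡⟨ C-! e (suc q) ⟩
  (e + suc q) !                         ≡⟨ rising-! e q ⟨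
  rising e q * (suc e * e !)            ≡⟨ *-assoc (rising e q) (suc e) (e !) ⟨
  rising e q * suc e * e !              ∎)
  where open ≡-Reasoning

^-cancelˡ-≤ : ∀ {m n} k .{{_ : NonZero k}} → m ^ k ≤ n ^ k → m ≤ n
^-cancelˡ-≤ {m} {n} k mᵏ≤nᵏ with m ≤? n
... | yes m≤n = m≤n
... | no m≰n = ⊥-elim (<⇒≱ (^-monoˡ-< k (≰⇒> m≰n)) mᵏ≤nᵏ)

^-swap : ∀ a m n → (a ^ m) ^ n ≡ (a ^ n) ^ m
^-swap a m n = trans (^-*-assoc a m n) (trans (cong (a ^_) (*-comm m n)) (sym (^-*-assoc a n m)))

-- `U j k` abstracts `potential F j k` with `j` points chosen and `k` to come; keeping both indices
-- avoids truncated subtraction. The slack `e` is ℓ - p for p = q + 1.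
module _ (U : ℕ → ℕ → ℕ) (U≢0 : ∀ j k → NonZero (U j k)) (e q N : ℕ)
  (top : U (suc q) 0 ≡ 1)
  (concave : ∀ j k → j + suc (suc k) ≡ suc q →
    U (suc j) (suc k) * U (suc j) (suc k) * suc (suc (e + k)) ^ N
      ≤ U (suc (suc j)) k * suc (e + k) ^ N * U j (suc (suc k)))
  where

  open ≤-Reasoning

  private
    c = U q 1
    E = suc e ^ N

  -- The quotient of `U j (suc k)` by `U (suc j) k` is an exponentiated increment, and by `top` the
  -- last one is `c`. The factors (e + i + 2) / (e + i + 1) telescope to (e + 1 + k) / (e + 1).
  increment-≤ : ∀ k j → j + suc k ≡ suc q → U (suc j) k * c * suc (e + k) ^ N ≤ U j (suc k) * E
  increment-≤ zero j eq with refl ← suc-injective (trans (+-comm 1 j) eq) = begin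
    U (suc q) 0 * c * suc (e + 0) ^ N  ≡⟨ cong₂ (λ u z → u * c * suc z ^ N) top (+-identityʳ e) ⟩
    1 * c * E                          ≡⟨ cong (_* E) (*-identityˡ c) ⟩
    c * E                              ∎
  increment-≤ (suc k) j eq = *-cancelˡ-≤ x {{U≢0 (suc j) (suc k)}} (begin
    x * (x * c * suc (e + suc k) ^ N) ≡⟨ cong (λ z → x * (x * c * suc z ^ N)) (+-suc e k) ⟩
    x * (x * c * a)                   ≡⟨ lem₁ x c a ⟩
    c * (x * x * a)                   ≤⟨ *-monoʳ-≤ c (concave j k eq) ⟩
    c * (y * b * z)                   ≡⟨ lem₂ c y b z ⟩
    z * (y * c * b)                   ≤⟨ *-monoʳ-≤ z (increment-≤ k (suc j) (trans (sym (+-suc j (suc k))) eq)) ⟩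
    z * (x * E)                       ≡⟨ lem₃ z x E ⟩
    x * (z * E)                       ∎)
    where
    x = U (suc j) (suc k)
    y = U (suc (suc j)) k
    z = U j (suc (suc k))
    a = suc (suc (e + k)) ^ N
    b = suc (e + k) ^ N
    lem₁ : ∀ x c a → x * (x * c * a) ≡ c * (x * x * a)
    lem₁ = solve-∀
    lem₂ : ∀ c y b z → c * (y * b * z) ≡ z * (y * c * b)
    lem₂ = solve-∀
    lem₃ : ∀ z x e → z * (x * e) ≡ x * (z * e)
    lem₃ = solve-∀

  -- Product of the last `suc k` increments; the final one is `c` itself, hence one power of `E`
  -- fewer than of `c`.
  telescope : ∀ k j → j + suc k ≡ suc q → c ^ suc k * rising e k ^ N ≤ U j (suc k) * E ^ k
  telescope zero j eq with refl ← suc-injective (trans (+-comm 1 j) eq) =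
    ≤-reflexive (trans (cong (c * 1 *_) (^-zeroˡ N)) (lem c))
    where
    lem : ∀ c → c * 1 * 1 ≡ c * 1
    lem = solve-∀
  telescope (suc k) j eq = begin
    c * c ^ suc k * (suc (suc (e + k)) * rising e k) ^ N ≡⟨ cong (c * c ^ suc k *_) (^-distribʳ-* (suc (suc (e + k))) (rising e k) N) ⟩
    c * c ^ suc k * (a * rising e k ^ N)                 ≡⟨ lem₁ c (c ^ suc k) a (rising e k ^ N) ⟩
    c * a * (c ^ suc k * rising e k ^ N)                 ≤⟨ *-monoʳ-≤ (c * a) (telescope k (suc j) (trans (sym (+-suc j (suc k))) eq)) ⟩
    c * a * (x * E ^ k)                                  ≡⟨ lem₂ c a x (E ^ k) ⟩
    x * c * a * E ^ k                                    ≡⟨ cong (λ z → x * c * suc z ^ N * E ^ k) (+-suc e k) ⟨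
    x * c * suc (e + suc k) ^ N * E ^ k                  ≤⟨ *-monoˡ-≤ (E ^ k) (increment-≤ (suc k) j eq) ⟩
    U j (suc (suc k)) * E * E ^ k                        ≡⟨ *-assoc (U j (suc (suc k))) E (E ^ k) ⟩
    U j (suc (suc k)) * (E * E ^ k)                      ∎
    where
    x = U (suc j) (suc k)
    a = suc (suc (e + k)) ^ N
    lem₁ : ∀ c d a r → c * d * (a * r) ≡ c * a * (d * r)
    lem₁ = solve-∀
    lem₂ : ∀ c a x f → c * a * (x * f) ≡ x * c * a * f
    lem₂ = solve-∀

  telescoped : ∀ {T} .{{_ : NonZero q}} → U 0 (suc q) ≡ N ^ N → N ^ N ≤ c * T ^ N →
    N ^ q * rising e q ≤ T ^ suc q * suc e ^ q
  telescoped {T} U₀ N≤ with N ≟ 0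
  -- No N-th root can be taken for an empty family; there the left side vanishes because `q` is
  -- positive.
  ... | yes N≡0 = ≤-trans (≤-reflexive (trans (cong (λ z → z ^ q * rising e q) N≡0) (cong (_* rising e q) (0^ q)))) z≤n
    where
    0^ : ∀ k .{{_ : NonZero k}} → 0 ^ k ≡ 0
    0^ (suc k) = refl
  -- The lower bound on `c` enters to the power `suc q`; one `N ^ N` then cancels and both sides are
  -- N-th powers.
  ... | no N≢0 = ^-cancelˡ-≤ N {{≢-nonZero N≢0}} (*-cancelˡ-≤ (N ^ N) {{n^n≢0 N}} (begin
    N ^ N * (N ^ q * φ) ^ N          ≡⟨ cong (N ^ N *_) (trans (^-distribʳ-* (N ^ q) φ N) (cong (_* φ ^ N) (^-swap N q N))) ⟩
    N ^ N * ((N ^ N) ^ q * φ ^ N)    ≡⟨ *-assoc (N ^ N) _ _ ⟨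
    (N ^ N) ^ suc q * φ ^ N          ≤⟨ *-monoˡ-≤ (φ ^ N) (^-monoˡ-≤ (suc q) N≤) ⟩
    (c * T ^ N) ^ suc q * φ ^ N      ≡⟨ cong (_* φ ^ N) (^-distribʳ-* c (T ^ N) (suc q)) ⟩
    c ^ suc q * (T ^ N) ^ suc q * φ ^ N ≡⟨ lem (c ^ suc q) ((T ^ N) ^ suc q) (φ ^ N) ⟩
    c ^ suc q * φ ^ N * (T ^ N) ^ suc q ≤⟨ *-monoˡ-≤ ((T ^ N) ^ suc q) (telescope q 0 refl) ⟩
    U 0 (suc q) * E ^ q * (T ^ N) ^ suc q ≡⟨ cong₂ (λ u t → u * E ^ q * t) U₀ (^-swap T N (suc q)) ⟩
    N ^ N * E ^ q * (T ^ suc q) ^ N  ≡⟨ cong (λ z → N ^ N * z * (T ^ suc q) ^ N) (^-swap (suc e) N q) ⟩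
    N ^ N * (suc e ^ q) ^ N * (T ^ suc q) ^ N ≡⟨ lem′ (N ^ N) ((suc e ^ q) ^ N) ((T ^ suc q) ^ N) ⟩
    N ^ N * ((T ^ suc q) ^ N * (suc e ^ q) ^ N) ≡⟨ cong (N ^ N *_) (^-distribʳ-* (T ^ suc q) (suc e ^ q) N) ⟨
    N ^ N * (T ^ suc q * suc e ^ q) ^ N ∎))
    where
    φ = rising e q
    lem : ∀ a b c → a * b * c ≡ a * c * b
    lem = solve-∀
    lem′ : ∀ a b c → a * b * c ≡ a * (c * b)
    lem′ = solve-∀

-- Multiplying by `rising e q ^ q` completes both sides: `rising e q` is q! times one binomial
-- coefficient, and `rising e q * suc e` is (q + 1)! times the other.
divide-! : ∀ e q x y → (suc q ! * x) ^ q * rising e q ≤ (q ! * y) ^ suc q * suc e ^ q →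
  x ^ q * ((e + suc q) C q) ^ suc q ≤ y ^ suc q * ((e + suc q) C suc q) ^ q
divide-! e q x y hyp =
  *-cancelʳ-≤ _ _ ((suc q !) ^ q * (q !) ^ suc q) {{m*n≢0 _ _ {{m^n≢0 (suc q !) q {{suc q !≢0}}}} {{m^n≢0 (q !) (suc q) {{q !≢0}}}}}} (begin
  x ^ q * Cq ^ suc q * ((suc q !) ^ q * (q !) ^ suc q)
    ≡⟨ lem₁ (x ^ q) (Cq ^ suc q) ((suc q !) ^ q) ((q !) ^ suc q) ⟩
  (suc q !) ^ q * x ^ q * (Cq ^ suc q * (q !) ^ suc q)
    ≡⟨ cong₂ _*_ (^-distribʳ-* (suc q !) x q) (^-distribʳ-* Cq (q !) (suc q)) ⟨
  (suc q ! * x) ^ q * (Cq * q !) ^ suc q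
    ≡⟨ cong (λ z → (suc q ! * x) ^ q * z ^ suc q) (C-rising e q) ⟩
  (suc q ! * x) ^ q * (φ * φ ^ q)
    ≡⟨ *-assoc ((suc q ! * x) ^ q) φ (φ ^ q) ⟨
  (suc q ! * x) ^ q * φ * φ ^ q
    ≤⟨ *-monoˡ-≤ (φ ^ q) hyp ⟩
  (q ! * y) ^ suc q * suc e ^ q * φ ^ q
    ≡⟨ lem₂ ((q ! * y) ^ suc q) (suc e ^ q) (φ ^ q) ⟩
  (q ! * y) ^ suc q * (φ ^ q * suc e ^ q)
    ≡⟨ cong ((q ! * y) ^ suc q *_) (^-distribʳ-* φ (suc e) q) ⟨
  (q ! * y) ^ suc q * (φ * suc e) ^ q
    ≡⟨ cong (λ z → (q ! * y) ^ suc q * z ^ q) (C-rising-suc e q) ⟨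
  (q ! * y) ^ suc q * (Cp * suc q !) ^ q
    ≡⟨ cong₂ _*_ (^-distribʳ-* (q !) y (suc q)) (^-distribʳ-* Cp (suc q !) q) ⟩
  (q !) ^ suc q * y ^ suc q * (Cp ^ q * (suc q !) ^ q)
    ≡⟨ lem₃ ((q !) ^ suc q) (y ^ suc q) (Cp ^ q) ((suc q !) ^ q) ⟩
  y ^ suc q * Cp ^ q * ((suc q !) ^ q * (q !) ^ suc q) ∎)
  where
  open ≤-Reasoning
  φ = rising e q
  Cq = (e + suc q) C q
  Cp = (e + suc q) C suc q
  lem₁ : ∀ a b c d → a * b * (c * d) ≡ c * a * (b * d)
  lem₁ = solve-∀
  lem₂ : ∀ a b c → a * b * c ≡ a * (c * b)
  lem₂ = solve-∀
  lem₃ : ∀ a b c d → a * b * (c * d) ≡ b * c * (d * a)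
  lem₃ = solve-∀

-- Shadows

open import Data.Integer using (ℤ; +_; -[1+_])
import Data.Integer as ℤ
import Data.Integer.Properties as ℤ

up×-1 : ∀ k (f : Subset n → ℕ) → (∀ A → f A ≡ 1) → ∀ A → up× k f A ≡ 1
up×-1 zero f f≡1 A = f≡1 A
up×-1 (suc k) f f≡1 A = trans (ℙ-cong (up×-1 k f f≡1) A) (trans (ℙ-^ 1 (λ _ → 0) A) (^-zeroˡ (𝔼 (λ _ → 0) A)))

up×≢0 : ∀ k (f : Subset n → ℕ) → (∀ A → NonZero (f A)) → ∀ A → NonZero (up× k f A)
up×≢0 k f f≢0 A = >-nonZero (≤-trans (≤-reflexive (sym (up×-1 k (λ _ → 1) (λ _ → refl) A)))
  (up×-mono k (λ B → >-nonZero⁻¹ (f B) {{f≢0 B}}) A))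

family-shadow-bound : ∀ e q .{{_ : NonZero q}} (F G : Subset n → ℕ) →
  (∀ A → F A ≤ 1) → (∀ A → NonZero (F A) → ∣ A ∣ ≡ suc q) → (∀ A → NonZero (G A) → ∣ A ∣ ≡ q) →
  (∀ A → NonZero (𝔼 F A) → 1 ≤ G A) →
  (∀ xs → AllPairs (Linked (NonZero ∘ F)) xs → length xs ≢ suc (e + suc q)) →
  total F ^ q * ((e + suc q) C q) ^ suc q ≤ total G ^ suc q * ((e + suc q) C suc q) ^ q
family-shadow-bound e q F G F≤1 F-unif G-unif shadow free =
  divide-! e q (total F) (total G)
    (subst₂ (λ N T → N ^ q * rising e q ≤ T ^ suc q * suc e ^ q) (up-∅ F F-unif) (up-∅ G G-unif)
      (telescoped (potential F)
        (λ j k → up×≢0 j (self (up k F)) (λ A → n^n≢0 (up k F A)) ∅)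
        e q N
        -- A full tuple has weight 0 or 1, so no uncertainty is left after all points are revealed.
        (up×-1 (suc q) (self F) F-self ∅)
        concave refl N≤))
  where
  N = up (suc q) F ∅
  F-self : ∀ A → F A ^ F A ≡ 1
  F-self A with F A | F≤1 A
  ... | zero | _ = refl
  ... | suc zero | _ = refl
  ... | suc (suc _) | s≤s ()
  concave : ∀ j k → j + suc (suc k) ≡ suc q →
    potential F (suc j) (suc k) * potential F (suc j) (suc k) * suc (suc (e + k)) ^ N
      ≤ potential F (suc (suc j)) k * suc (e + k) ^ N * potential F j (suc (suc k))
  concave j k eq = subst
    (λ p → potential F (suc j) (suc k) * potential F (suc j) (suc k) * suc (suc (e + k)) ^ up p F ∅
      ≤ potential F (suc (suc j)) k * suc (e + k) ^ up p F ∅ * potential F j (suc (suc k))) eq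
    -- Links have no clique on e + k + 3 = m + 2 vertices, whence m = e + k + 1.
    (potential-concave F j k (suc (e + k)) (link-clique-free k F F-unif free))
  N≤ : N ^ N ≤ potential F q 1 * up q G ∅ ^ N
  N≤ = subst (λ N → N ^ N ≤ potential F q 1 * up q G ∅ ^ N)
    (cong (λ h → h ∅) (trans (sym (fold-+ F 𝔼 q)) (cong (λ p → up p F) (+-comm q 1))))
    (entropy≤support q shadow ∅)

module _ {n r : ℕ} (H : RGraph n r) where

  Complete : Subset n → Set
  Complete A = ∀ Y → Y ⊆ A → ∣ Y ∣ ≡ r → Edge H Y

  -- The pair is enlarged inside `B` to an `r`-set, which completeness makes an edge; `2 ≤ r` gives
  -- it room.
  complete-linked : ∀ {B u v} → 2 ≤ r → r ≤ ∣ B ∣ → Complete B → u ≢ v → u ∈ B → v ∈ B → Linked (Edge H) u v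
  complete-linked {B} {u} {v} 2≤r r≤B complete u≢v u∈B v∈B =
    let Y , uv⊆Y , Y⊆B , ∣Y∣ = interpolate r {X} {B} X⊆B (≤-trans (≤-reflexive ∣X∣) 2≤r) r≤B in
    u≢v , Y , complete Y Y⊆B ∣Y∣ , uv⊆Y (⊆-insert (∅ [ u ]≔ inside) v ([]≔-updates ∅ u)) ,
    uv⊆Y ([]≔-updates (∅ [ u ]≔ inside) v)
    where
    X = (∅ [ u ]≔ inside) [ v ]≔ inside
    only-u : ∀ {x} → x ∈ ∅ [ u ]≔ inside → x ≡ u
    only-u x∈ with ∈-insert⁻ ∅ u x∈
    ... | inj₁ x≡u = x≡u
    ... | inj₂ x∈∅ = ⊥-elim (∉⊥ x∈∅)
    X⊆B : X ⊆ B
    X⊆B x∈X with ∈-insert⁻ (∅ [ u ]≔ inside) v x∈X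
    ... | inj₁ refl = v∈B
    ... | inj₂ x∈ rewrite only-u x∈ = u∈B
    ∣X∣ : ∣ X ∣ ≡ 2
    ∣X∣ = trans (∣insert∣ (∅ [ u ]≔ inside) v (∉⇒lookup≡false (λ v∈ → u≢v (sym (only-u v∈)))))
      (cong suc (trans (∣insert∣ ∅ u (∉⇒lookup≡false {A = ∅ {n}} {u} ∉⊥)) (cong suc (∣⊥∣≡0 n))))

  shadow-linked : ∀ i → 2 ≤ r → ∀ {u v} → Linked (Shadow H i) u v → Linked (Edge H) u v
  shadow-linked (+ suc j) 2≤r (u≢v , B , (_ , D , ED , B⊆D) , u∈B , v∈B) = u≢v , D , ED , B⊆D u∈B , B⊆D v∈B
  shadow-linked (+ zero) 2≤r (u≢v , B , (∣B∣ , complete) , u∈B , v∈B) =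
    complete-linked 2≤r (≤-reflexive (sym ∣B∣)) complete u≢v u∈B v∈B
  shadow-linked -[1+ j ] 2≤r (u≢v , B , (∣B∣ , complete) , u∈B , v∈B) =
    complete-linked 2≤r (≤-trans (m≤m+n r (suc j)) (≤-reflexive (sym ∣B∣))) complete u≢v u∈B v∈B

  shadow-⊆ : ∀ i {A B} → Shadow H i B → A ⊆ B → ShadowCond H (i ℤ.+ + 1) A
  shadow-⊆ (+ suc j) (_ , D , ED , B⊆D) A⊆B = D , ED , ⊆-trans A⊆B B⊆D
  -- Here the condition changes kind, from complete sets to subsets of edges: a complete `r`-set is
  -- itself an edge.
  shadow-⊆ (+ zero) {B = B} (∣B∣ , complete) A⊆B = B , complete B ⊆-refl ∣B∣ , A⊆B
  shadow-⊆ -[1+ zero ] (_ , complete) A⊆B Y Y⊆A = complete Y (⊆-trans Y⊆A A⊆B)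
  shadow-⊆ -[1+ suc j ] (_ , complete) A⊆B Y Y⊆A = complete Y (⊆-trans Y⊆A A⊆B)

-- The upper bound on `i` keeps the subtraction in `sz` from truncating, so the two sizes are
-- consecutive and the smaller is positive.
sz-suc : ∀ {r} → 2 ≤ r → ∀ i → i ℤ.≤ (+ r ℤ.- + 2) → ∃ λ q → sz r i ≡ suc (suc q) × sz r (i ℤ.+ + 1) ≡ suc q
sz-suc {r} 2≤r (+ k) i≤ with k≤ ← ℤ.drop‿+≤+ (subst (+ k ℤ.≤_) (trans (ℤ.m-n≡m⊖n r 2) (ℤ.⊖-≥ 2≤r)) i≤)
  with o , refl ← m≤n⇒∃[o]m+o≡n (m≤o∸n⇒m+n≤o k 2≤r k≤) = o , lem₁ , lem₂
  where
  lem₁ : (k + 2 + o) ∸ k ≡ suc (suc o)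
  lem₁ = trans (cong (_∸ k) (+-assoc k 2 o)) (m+n∸m≡n k (2 + o))
  lem₂ : (k + 2 + o) ∸ (k + 1) ≡ suc o
  lem₂ = trans (cong (_∸ (k + 1)) (trans (+-assoc k 2 o) (sym (+-assoc k 1 (suc o))))) (m+n∸m≡n (k + 1) (suc o))
sz-suc {suc (suc r)} (s≤s (s≤s z≤n)) -[1+ zero ] _ = suc r , cong (λ z → suc (suc z)) (+-comm r 1) , refl
sz-suc {suc (suc r)} (s≤s (s≤s z≤n)) -[1+ suc j ] _ = suc (r + suc j) , cong (λ z → suc (suc z)) (+-suc r (suc j)) , refl

sz≤ : ∀ {r ℓ} → r ≤ ℓ → ∀ i → (+ r ℤ.- + ℓ) ℤ.≤ i → sz r i ≤ ℓ
sz≤ {r} r≤ℓ (+ k) _ = ≤-trans (m∸n≤m r k) r≤ℓ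
sz≤ {r} {ℓ} r≤ℓ -[1+ j ] ≤i = subst (r + suc j ≤_) (m+[n∸m]≡n r≤ℓ) (+-monoʳ-≤ r
  (ℤ.drop‿+≤+ (ℤ.neg-cancel-≤ (subst (ℤ._≤ -[1+ j ]) (trans (ℤ.m-n≡m⊖n r ℓ) (ℤ.⊖-≤ r≤ℓ)) ≤i))))

-- The inequality is stated after raising it to the power (r - i)(r - i - 1) and clearing
-- denominators.
theorem1p17 : (ℓ r : ℕ) → 2 ≤ r → r ≤ ℓ → (n : ℕ) (H : RGraph n r) → KFree ℓ H →
    (i : ℤ) → (+ r ℤ.- + ℓ) ℤ.≤ i → i ℤ.≤ (+ r ℤ.- + 2) →
    ∣∂∣ H i ^ sz r (i ℤ.+ + 1) * (ℓ C sz r (i ℤ.+ + 1)) ^ sz r i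
    ≤ ∣∂∣ H (i ℤ.+ + 1) ^ sz r i * (ℓ C sz r i) ^ sz r (i ℤ.+ + 1)
theorem1p17 ℓ r 2≤r r≤ℓ n H free i ≤i i≤
  with q , p≡ , q≡ ← sz-suc 2≤r i i≤
  with e+p≡ℓ ← m∸n+n≡m (subst (_≤ ℓ) p≡ (sz≤ r≤ℓ i ≤i))
  = transport p≡ q≡ e+p≡ℓ (countSub≡total (shadow? H i)) (countSub≡total (shadow? H (i ℤ.+ + 1)))
    (family-shadow-bound (ℓ ∸ suc (suc q)) (suc q) F G
    (λ A → ⟦does⟧≤ (shadow? H i A) (λ _ → ≤-refl))
    (λ A FA → trans (proj₁ (F⇒ A FA)) p≡)
    (λ A GA → trans (proj₁ (⟦does⟧≢0 (shadow? H (i ℤ.+ + 1) A) GA)) q≡)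
    shadow
    (λ xs links len → KFree⇒linked-free H free xs (AllPairs.map link links) (trans len (cong suc e+p≡ℓ))))
  where
  transport : ∀ {p p′ q q′ m x x′ y y′} → p ≡ p′ → q ≡ q′ → m ≡ ℓ → x ≡ x′ → y ≡ y′ →
    x′ ^ q′ * (m C q′) ^ p′ ≤ y′ ^ p′ * (m C p′) ^ q′ → x ^ q * (ℓ C q) ^ p ≤ y ^ p * (ℓ C p) ^ q
  transport refl refl refl refl refl = id
  F G : Subset n → ℕ
  F = indicator (shadow? H i)
  G = indicator (shadow? H (i ℤ.+ + 1))
  F⇒ : ∀ A → NonZero (F A) → Shadow H i A
  F⇒ A = ⟦does⟧≢0 (shadow? H i A)
  link : ∀ {u v} → Linked (NonZero ∘ F) u v → Linked (Edge H) u v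
  link (u≢v , B , FB , uv∈B) = shadow-linked H i 2≤r (u≢v , B , F⇒ B FB , uv∈B)
  shadow : ∀ A → NonZero (𝔼 F A) → 1 ≤ G A
  shadow A nz with B , FB , A⊆B , ∣B∣ ← up≢0⇒∃ 1 F A nz =
    ≤-reflexive (sym (⟦does⟧≡1 (shadow? H (i ℤ.+ + 1) A)
      (trans (suc-injective (trans (sym ∣B∣) (trans (proj₁ (F⇒ B FB)) p≡))) (sym q≡) , shadow-⊆ H i (F⇒ B FB) A⊆B)))
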